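{- Let $\ell\ge 5$ be a prime number, $N>0$ an integer prime to $\ell$, and $k>2$ an integer. Let $f\in S_{k}(\Gamma_{0}(N))$ be a normalized eigenform and let $\lambda$ be a prime of $K_f$ lying over $\ell$. Suppose the representation $\rho_{f,\lambda}$ is irreducible. Let $i$ be an integer with $0\le i \le \ell-1$ such that, with $$H=\{x \bmod N\ell \ :\ 0<x<N\ell,\ \gcd(x,N\ell)=1,\ \varepsilon(x)\,x^{k-2-2i} \equiv 1 \bmod \lambda \}\subseteq (\mathbb{Z}/N\ell\mathbb{Z})^{*},\qquad \Gamma_H=\Gamma_H(N\ell)$$ (where $\varepsilon$ is the nebentypus character of $f$, here trivial), there exist a normalized eigenform $f_2\in S_2(\Gamma_H)$ and a prime $\lambda_2$ of $K_{f_2}$ over $\ell$ with $\rho_{f,\lambda}\cong\rho_{f_2,\lambda_2}\otimes\chi_\ell^i$. Then the index of $\Gamma_{1}(N\ell)$ in $\Gamma_H$ is $$[\Gamma_{H}:\Gamma_1(N\ell)]=\frac{\phi(N\ell)\cdot \gcd(\ell-1,\,k-2-2i)}{\ell-1}.$$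
   Context: $\phi$ is Euler's totient function. For a positive integer $n$ and a subgroup $H$ of $(\mathbb{Z}/n\mathbb{Z})^{*}$, $\Gamma_H(n)$ is the group of matrices $\begin{pmatrix} a&b\\c&d\end{pmatrix}\in SL(2,\mathbb{Z})$ with $c\equiv 0 \pmod n$ and $d \bmod n\in H$; $\Gamma_0(n)$ and $\Gamma_1(n)$ are the cases $H=(\mathbb{Z}/n\mathbb{Z})^*$ and $H=\{1\}$. $S_k(\Gamma)$ is the space of cusp forms of weight $k$ on $\Gamma$. A normalized eigenform $g=\sum_{m>0}a_m(g)q^m$ is a Hecke eigenform with $a_1(g)=1$; $K_g$ is the number field generated by all the coefficients $a_m(g)$. For a normalized eigenform $g\in S_k(\Gamma_1(n))$ with nebentypus $\varepsilon$ and a prime $\mu$ of $K_g$ over $\ell$, with residue field embedded in $\overline{\mathbb{F}}_\ell$, $\rho_{g,\mu}:\mathrm{Gal}(\overline{\mathbb{Q}}/\mathbb{Q})\to GL_2(\overline{\mathbb{F}}_\ell)$ is the unique (up to isomorphism) continuous semisimple representation, unramified outside $n\ell$, such that for all primes $p\nmid n\ell$ the characteristic polynomial of $\rho_{g,\mu}(\mathrm{Frob}_p)$ is $x^2-a_p(g)x+\varepsilon(p)p^{k-1} \bmod \mu$; isomorphisms between representations attached to different forms are understood for suitable embeddings of residue fields. $\chi_\ell$ is the mod $\ell$ cyclotomic character. Negative powers of $x$ are taken modulo $\ell$. -}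

module Defs where

open import Level using (0ℓ)
open import Algebra.Bundles using (CommutativeRing)
open import Algebra.Bundles.Raw using (RawRing)
import Algebra.Definitions.RawSemiring as RawSemiringDefs
open import Data.Bool.Base using (if_then_else_; _∧_)
open import Data.Fin.Base using (Fin; toℕ)
open import Data.Integer.Base as ℤ using (ℤ; +_; -[1+_]; 0ℤ; 1ℤ)
import Data.Integer.Divisibility.Signed as ℤˢ
open import Data.Integer.Divisibility using (_∣_)
import Data.Integer.Properties as ℤ
open import Data.Integer.Tactic.RingSolver using (solve-∀)
open import Data.List.Base using (List; []; _∷_; foldr; map; length; filter; upTo; _∷ʳ_)
open import Data.List.Relation.Unary.All using (All)
open import Data.List.Relation.Unary.Any using (Any)
open import Data.Nat.Base as ℕ using (ℕ; zero; suc; NonZero; _!)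
import Data.Nat.Properties as ℕ
import Data.Nat.DivMod as ℕ
import Data.Nat.Divisibility as ℕ∣
open import Data.Nat.Coprimality as Coprime using (Coprime; coprime?)
open import Data.Nat.Primality using (Prime)
open import Data.Product using (Σ; ∃; ∃-syntax; _×_; _,_; proj₁)
open import Data.Rational.Base as ℚ using (ℚ; 0ℚ; 1ℚ; ½)
import Data.Rational.Properties as ℚ
open import Data.Rational.Solver using (module +-*-Solver)
open import Data.Sum.Base using (_⊎_)
open import Function.Base using (_∘_)
open import Relation.Binary.PropositionalEquality.Core
  using (_≡_; _≢_; refl; sym; trans; cong; cong₂; subst)
open import Relation.Nullary using (¬_; yes; no; contradiction)
open import Relation.Nullary.Decidable using (⌊_⌋)

φ : ℕ → ℕ
φ n = length (filter (λ x → coprime? x n) (map suc (upTo n)))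

-- "y represents x ^ e in ℤ/ℓ"; a negative power is that of an inverse modulo ℓ.
IsPowerMod : ℕ → ℕ → ℤ → ℤ → Set
IsPowerMod ℓ x (+ e)    y = + ℓ ∣ (y ℤ.- (+ x) ℤ.^ e)
IsPowerMod ℓ x -[1+ e ] y = + ℓ ∣ (y ℤ.* (+ x) ℤ.^ suc e ℤ.- 1ℤ)

pred-nonZero : ∀ {ℓ} → 5 ℕ.≤ ℓ → NonZero (ℓ ℕ.∸ 1)
pred-nonZero (ℕ.s≤s (ℕ.s≤s _)) = _

record SL₂ℤ : Set where
  constructor mkSL₂
  field
    a b c d : ℤ
    det≡1   : a ℤ.* d ℤ.- b ℤ.* c ≡ 1ℤ

private
  det-mult : ∀ a b c d a′ b′ c′ d′ →
    (a ℤ.* a′ ℤ.+ b ℤ.* c′) ℤ.* (c ℤ.* b′ ℤ.+ d ℤ.* d′)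
      ℤ.- (a ℤ.* b′ ℤ.+ b ℤ.* d′) ℤ.* (c ℤ.* a′ ℤ.+ d ℤ.* c′)
    ≡ (a ℤ.* d ℤ.- b ℤ.* c) ℤ.* (a′ ℤ.* d′ ℤ.- b′ ℤ.* c′)
  det-mult = solve-∀

  det-inv : ∀ a b c d → d ℤ.* a ℤ.- (ℤ.- b) ℤ.* (ℤ.- c) ≡ a ℤ.* d ℤ.- b ℤ.* c
  det-inv a b c d = cong₂ ℤ._-_ (ℤ.*-comm d a)
    (trans (sym (ℤ.neg-distribˡ-* b (ℤ.- c)))
      (trans (cong ℤ.-_ (sym (ℤ.neg-distribʳ-* b c))) (ℤ.neg-involutive (b ℤ.* c))))

infixl 7 _·_

_·_ : SL₂ℤ → SL₂ℤ → SL₂ℤ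
mkSL₂ a b c d p · mkSL₂ a′ b′ c′ d′ p′ = mkSL₂
  (a ℤ.* a′ ℤ.+ b ℤ.* c′) (a ℤ.* b′ ℤ.+ b ℤ.* d′)
  (c ℤ.* a′ ℤ.+ d ℤ.* c′) (c ℤ.* b′ ℤ.+ d ℤ.* d′)
  (trans (det-mult a b c d a′ b′ c′ d′) (cong₂ ℤ._*_ p p′))

infix 8 _⁻¹

_⁻¹ : SL₂ℤ → SL₂ℤ
mkSL₂ a b c d p ⁻¹ = mkSL₂ d (ℤ.- b) (ℤ.- c) a (trans (det-inv a b c d) p)

-- A subset of ℤ/n is given by a set H of natural numbers, standing for the
-- classes of its members.
Γ[_,_] : ℕ → (ℕ → Set) → SL₂ℤ → Set
Γ[ n , H ] γ = + n ∣ SL₂ℤ.c γ × (∃[ x ] (H x × + n ∣ (SL₂ℤ.d γ ℤ.- + x)))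

units : ℕ → ℕ → Set
units n x = Coprime x n

Γ₀ Γ₁ : ℕ → SL₂ℤ → Set
Γ₀ n = Γ[ n , units n ]
Γ₁ n = Γ[ n , (λ x → x ≡ 1) ]

record HasIndex (G G′ : SL₂ℤ → Set) (m : ℕ) : Set where
  field
    subset : ∀ γ → G′ γ → G γ
    rep    : Fin m → SL₂ℤ
    rep∈G  : ∀ j → G (rep j)
    coset  : ∀ γ → G γ →
             ∃[ j ] (G′ (rep j ⁻¹ · γ) × (∀ j′ → G′ (rep j′ ⁻¹ · γ) → j′ ≡ j))

Cauchy : (ℕ → ℚ) → Set
Cauchy u = ∀ ε → 0ℚ ℚ.< ε →
  ∃[ M ] (∀ m n → M ℕ.≤ m → M ℕ.≤ n → ℚ.∣ u m ℚ.- u n ∣ ℚ.< ε)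

record ℝ : Set where
  constructor mkℝ
  field
    seq    : ℕ → ℚ
    cauchy : Cauchy seq
open ℝ

infix 4 _≈ℝ_ _<ℝ_ _≤ℝ_

-- Real arithmetic is opaque only to keep normal forms small.
opaque
  _≈ℝ_ : ℝ → ℝ → Set
  x ≈ℝ y = ∀ ε → 0ℚ ℚ.< ε → ∃[ M ] (∀ n → M ℕ.≤ n → ℚ.∣ seq x n ℚ.- seq y n ∣ ℚ.< ε)

  _<ℝ_ : ℝ → ℝ → Set
  x <ℝ y = ∃[ ε ] (0ℚ ℚ.< ε × ∃[ M ] (∀ n → M ℕ.≤ n → seq x n ℚ.+ ε ℚ.< seq y n))

  fromℚ : ℚ → ℝ
  fromℚ q = mkℝ (λ _ → q) λ ε ε>0 →
    0 , λ _ _ _ _ → subst (ℚ._< ε) (sym (cong ℚ.∣_∣ (ℚ.+-inverseʳ q))) ε>0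

_≤ℝ_ : ℝ → ℝ → Set
x ≤ℝ y = ¬ (y <ℝ x)

0ℝ 1ℝ : ℝ
0ℝ = fromℚ 0ℚ
1ℝ = fromℚ 1ℚ

private
  open import Data.Rational.Base using (∣_∣)
  module ℚSolve = +-*-Solver

  half>0 : ∀ ε → 0ℚ ℚ.< ε → 0ℚ ℚ.< ½ ℚ.* ε
  half>0 ε ε>0 = subst (ℚ._< ½ ℚ.* ε) (ℚ.*-zeroʳ ½) (ℚ.*-monoʳ-<-pos ½ {0ℚ} {ε} ε>0)

  halves : ∀ ε → ½ ℚ.* ε ℚ.+ ½ ℚ.* ε ≡ ε
  halves ε = trans (sym (ℚ.*-distribʳ-+ ε ½ ½)) (ℚ.*-identityˡ ε)

  +-regroup : ∀ a b c d → (a ℚ.+ b) ℚ.- (c ℚ.+ d) ≡ (a ℚ.- c) ℚ.+ (b ℚ.- d)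
  +-regroup = ℚSolve.solve 4 (λ a b c d →
    (a ℚSolve.:+ b) ℚSolve.:- (c ℚSolve.:+ d)
      ℚSolve.:= (a ℚSolve.:- c) ℚSolve.:+ (b ℚSolve.:- d)) refl

  *-regroup : ∀ a b c d → a ℚ.* b ℚ.- c ℚ.* d ≡ a ℚ.* (b ℚ.- d) ℚ.+ d ℚ.* (a ℚ.- c)
  *-regroup = ℚSolve.solve 4 (λ a b c d →
    (a ℚSolve.:* b) ℚSolve.:- (c ℚSolve.:* d)
      ℚSolve.:= (a ℚSolve.:* (b ℚSolve.:- d)) ℚSolve.:+ (d ℚSolve.:* (a ℚSolve.:- c))) refl

  neg-regroup : ∀ a b → (ℚ.- a) ℚ.- (ℚ.- b) ≡ ℚ.- (a ℚ.- b)
  neg-regroup = ℚSolve.solve 2 (λ a b →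
    (ℚSolve.:- a) ℚSolve.:- (ℚSolve.:- b) ℚSolve.:= ℚSolve.:- (a ℚSolve.:- b)) refl

  sub-add : ∀ a b → (a ℚ.- b) ℚ.+ b ≡ a
  sub-add = ℚSolve.solve 2 (λ a b → (a ℚSolve.:- b) ℚSolve.:+ b ℚSolve.:= a) refl

  eventuallyBounded : ∀ u → Cauchy u →
    ∃[ B ] (0ℚ ℚ.< B × ∃[ M ] (∀ n → M ℕ.≤ n → ∣ u n ∣ ℚ.≤ B))
  eventuallyBounded u cu =
    let M , close = cu 1ℚ (ℚ.positive⁻¹ 1ℚ)
    in 1ℚ ℚ.+ ∣ u M ∣
     , ℚ.+-mono-<-≤ {0ℚ} {1ℚ} {0ℚ} {∣ u M ∣} (ℚ.positive⁻¹ 1ℚ) (ℚ.0≤∣p∣ (u M))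
     , M
     , λ n M≤n → bound (u n) (u M) (ℚ.<⇒≤ (close n M M≤n ℕ.≤-refl))
    where
    bound : ∀ p q → ∣ p ℚ.- q ∣ ℚ.≤ 1ℚ → ∣ p ∣ ℚ.≤ 1ℚ ℚ.+ ∣ q ∣
    bound p q h = begin
      ∣ p ∣                     ≡⟨ cong ∣_∣ (sym (sub-add p q)) ⟩
      ∣ (p ℚ.- q) ℚ.+ q ∣       ≤⟨ ℚ.∣p+q∣≤∣p∣+∣q∣ (p ℚ.- q) q ⟩
      ∣ p ℚ.- q ∣ ℚ.+ ∣ q ∣     ≤⟨ ℚ.+-monoˡ-≤ ∣ q ∣ {∣ p ℚ.- q ∣} {1ℚ} h ⟩
      1ℚ ℚ.+ ∣ q ∣              ∎
      where open ℚ.≤-Reasoning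

  quotient>0 : ∀ B ε → 0ℚ ℚ.< B → 0ℚ ℚ.< ε → ∃[ δ ] (0ℚ ℚ.< δ × B ℚ.* δ ≡ ε)
  quotient>0 B ε B>0 ε>0 = δ , δ>0 , eq
    where
    instance
      B⁺ : ℚ.Positive B
      B⁺ = ℚ.positive B>0
      B≢0 : ℚ.NonZero B
      B≢0 = ℚ.pos⇒nonZero B
      1/B⁺ : ℚ.Positive (ℚ.1/ B)
      1/B⁺ = ℚ.1/pos⇒pos B
    δ = ℚ.1/ B ℚ.* ε
    δ>0 : 0ℚ ℚ.< δ
    δ>0 = subst (ℚ._< δ) (ℚ.*-zeroʳ (ℚ.1/ B)) (ℚ.*-monoʳ-<-pos (ℚ.1/ B) {0ℚ} {ε} ε>0)
    eq : B ℚ.* δ ≡ ε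
    eq = trans (sym (ℚ.*-assoc B (ℚ.1/ B) ε))
           (trans (cong (ℚ._* ε) (ℚ.*-inverseʳ B)) (ℚ.*-identityˡ ε))

  ∣*∣-bound : ∀ p q B δ → 0ℚ ℚ.< B → ∣ p ∣ ℚ.≤ B → ∣ q ∣ ℚ.< δ → ∣ p ℚ.* q ∣ ℚ.< B ℚ.* δ
  ∣*∣-bound p q B δ B>0 p≤B q<δ = begin-strict
    ∣ p ℚ.* q ∣       ≡⟨ ℚ.∣p*q∣≡∣p∣*∣q∣ p q ⟩
    ∣ p ∣ ℚ.* ∣ q ∣   ≤⟨ ℚ.*-monoʳ-≤-nonNeg ∣ q ∣ {{ℚ.∣-∣-nonNeg q}} {∣ p ∣} {B} p≤B ⟩
    B ℚ.* ∣ q ∣       <⟨ ℚ.*-monoʳ-<-pos B {{ℚ.positive B>0}} {∣ q ∣} {δ} q<δ ⟩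
    B ℚ.* δ           ∎
    where open ℚ.≤-Reasoning

  +-close : ∀ ε p q p′ q′ → ∣ p ℚ.- p′ ∣ ℚ.< ½ ℚ.* ε → ∣ q ℚ.- q′ ∣ ℚ.< ½ ℚ.* ε →
            ∣ (p ℚ.+ q) ℚ.- (p′ ℚ.+ q′) ∣ ℚ.< ε
  +-close ε p q p′ q′ hp hq = begin-strict
    ∣ (p ℚ.+ q) ℚ.- (p′ ℚ.+ q′) ∣          ≡⟨ cong ∣_∣ (+-regroup p q p′ q′) ⟩
    ∣ (p ℚ.- p′) ℚ.+ (q ℚ.- q′) ∣          ≤⟨ ℚ.∣p+q∣≤∣p∣+∣q∣ (p ℚ.- p′) (q ℚ.- q′) ⟩
    ∣ p ℚ.- p′ ∣ ℚ.+ ∣ q ℚ.- q′ ∣          <⟨ ℚ.+-mono-< {∣ p ℚ.- p′ ∣} {½ ℚ.* ε} {∣ q ℚ.- q′ ∣} {½ ℚ.* ε} hp hq ⟩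
    ½ ℚ.* ε ℚ.+ ½ ℚ.* ε                    ≡⟨ halves ε ⟩
    ε                                      ∎
    where open ℚ.≤-Reasoning

  *-close : ∀ B C δ p q p′ q′ → 0ℚ ℚ.< B → 0ℚ ℚ.< C → ∣ p ∣ ℚ.≤ B → ∣ q′ ∣ ℚ.≤ C →
            ∣ p ℚ.- p′ ∣ ℚ.< δ → ∣ q ℚ.- q′ ∣ ℚ.< δ →
            ∣ p ℚ.* q ℚ.- p′ ℚ.* q′ ∣ ℚ.< (B ℚ.+ C) ℚ.* δ
  *-close B C δ p q p′ q′ B>0 C>0 p≤B q′≤C hp hq = begin-strict
    ∣ p ℚ.* q ℚ.- p′ ℚ.* q′ ∣
      ≡⟨ cong ∣_∣ (*-regroup p q p′ q′) ⟩
    ∣ p ℚ.* (q ℚ.- q′) ℚ.+ q′ ℚ.* (p ℚ.- p′) ∣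
      ≤⟨ ℚ.∣p+q∣≤∣p∣+∣q∣ (p ℚ.* (q ℚ.- q′)) (q′ ℚ.* (p ℚ.- p′)) ⟩
    ∣ p ℚ.* (q ℚ.- q′) ∣ ℚ.+ ∣ q′ ℚ.* (p ℚ.- p′) ∣
      <⟨ ℚ.+-mono-< {∣ p ℚ.* (q ℚ.- q′) ∣} {B ℚ.* δ} {∣ q′ ℚ.* (p ℚ.- p′) ∣} {C ℚ.* δ}
           (∣*∣-bound p (q ℚ.- q′) B δ B>0 p≤B hq) (∣*∣-bound q′ (p ℚ.- p′) C δ C>0 q′≤C hp) ⟩
    B ℚ.* δ ℚ.+ C ℚ.* δ
      ≡⟨ sym (ℚ.*-distribʳ-+ δ B C) ⟩
    (B ℚ.+ C) ℚ.* δ ∎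
    where open ℚ.≤-Reasoning

  +-cauchy : ∀ u v → Cauchy u → Cauchy v → Cauchy (λ n → u n ℚ.+ v n)
  +-cauchy u v cu cv ε ε>0 =
    let M  , hu = cu (½ ℚ.* ε) (half>0 ε ε>0)
        M′ , hv = cv (½ ℚ.* ε) (half>0 ε ε>0)
    in M ℕ.⊔ M′ , λ m n le le′ → +-close ε (u m) (v m) (u n) (v n)
         (hu m n (ℕ.m⊔n≤o⇒m≤o M M′ le) (ℕ.m⊔n≤o⇒m≤o M M′ le′))
         (hv m n (ℕ.m⊔n≤o⇒n≤o M M′ le) (ℕ.m⊔n≤o⇒n≤o M M′ le′))

  neg-cauchy : ∀ u → Cauchy u → Cauchy (λ n → ℚ.- u n)
  neg-cauchy u cu ε ε>0 =
    let M , hu = cu ε ε>0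
    in M , λ m n le le′ → subst (ℚ._< ε)
         (sym (trans (cong ∣_∣ (neg-regroup (u m) (u n))) (ℚ.∣-p∣≡∣p∣ (u m ℚ.- u n))))
         (hu m n le le′)

  *-cauchy : ∀ u v → Cauchy u → Cauchy v → Cauchy (λ n → u n ℚ.* v n)
  *-cauchy u v cu cv ε ε>0 =
    let B , B>0 , M₁ , hB = eventuallyBounded u cu
        C , C>0 , M₂ , hC = eventuallyBounded v cv
        δ , δ>0 , eq      = quotient>0 (B ℚ.+ C) ε (ℚ.+-mono-< {0ℚ} {B} {0ℚ} {C} B>0 C>0) ε>0
        M₃ , hu           = cu δ δ>0
        M₄ , hv           = cv δ δ>0
        M₁₂ = M₁ ℕ.⊔ M₂
        M₃₄ = M₃ ℕ.⊔ M₄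
    in M₁₂ ℕ.⊔ M₃₄ , λ m n le le′ →
      let m₁₂ = ℕ.m⊔n≤o⇒m≤o M₁₂ M₃₄ le
          m₃₄ = ℕ.m⊔n≤o⇒n≤o M₁₂ M₃₄ le
          n₁₂ = ℕ.m⊔n≤o⇒m≤o M₁₂ M₃₄ le′
          n₃₄ = ℕ.m⊔n≤o⇒n≤o M₁₂ M₃₄ le′
      in subst (∣ u m ℚ.* v m ℚ.- u n ℚ.* v n ∣ ℚ.<_) eq
           (*-close B C δ (u m) (v m) (u n) (v n) B>0 C>0
             (hB m (ℕ.m⊔n≤o⇒m≤o M₁ M₂ m₁₂)) (hC n (ℕ.m⊔n≤o⇒n≤o M₁ M₂ n₁₂))
             (hu m n (ℕ.m⊔n≤o⇒m≤o M₃ M₄ m₃₄) (ℕ.m⊔n≤o⇒m≤o M₃ M₄ n₃₄))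
             (hv m n (ℕ.m⊔n≤o⇒n≤o M₃ M₄ m₃₄) (ℕ.m⊔n≤o⇒n≤o M₃ M₄ n₃₄)))

infixl 6 _+ℝ_ _-ℝ_
infixl 7 _*ℝ_
infix  8 -ℝ_

opaque
  -ℝ_ : ℝ → ℝ
  -ℝ mkℝ u cu = mkℝ (λ n → ℚ.- u n) (neg-cauchy u cu)

  _+ℝ_ _*ℝ_ : ℝ → ℝ → ℝ
  mkℝ u cu +ℝ mkℝ v cv = mkℝ (λ n → u n ℚ.+ v n) (+-cauchy u v cu cv)
  mkℝ u cu *ℝ mkℝ v cv = mkℝ (λ n → u n ℚ.* v n) (*-cauchy u v cu cv)

_-ℝ_ : ℝ → ℝ → ℝ
x -ℝ y = x +ℝ (-ℝ y)

-- Polynomials are lists of coefficients, constant term first.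
module Polynomials (R : RawRing 0ℓ 0ℓ) where
  open RawRing R
  open RawSemiringDefs rawSemiring renaming (_×_ to _⊗_) using (_^_)

  fromℤ : ℤ → Carrier
  fromℤ (+ n)    = n ⊗ 1#
  fromℤ -[1+ n ] = - (suc n ⊗ 1#)

  eval : List Carrier → Carrier → Carrier
  eval cs x = foldr (λ c acc → c + x * acc) 0# cs

  evalℤ : List ℤ → Carrier → Carrier
  evalℤ cs = eval (map fromℤ cs)

record ℂ : Set where
  constructor _+i_
  field
    re im : ℝ
open ℂ

ℂ-rawRing : RawRing 0ℓ 0ℓ
ℂ-rawRing = record
  { Carrier = ℂ
  ; _≈_     = λ z w → re z ≈ℝ re w × im z ≈ℝ im w
  ; _+_     = λ z w → (re z +ℝ re w) +i (im z +ℝ im w)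
  ; _*_     = λ z w → (re z *ℝ re w -ℝ im z *ℝ im w) +i (re z *ℝ im w +ℝ im z *ℝ re w)
  ; -_      = λ z → (-ℝ re z) +i (-ℝ im z)
  ; 0#      = 0ℝ +i 0ℝ
  ; 1#      = 1ℝ +i 0ℝ
  }

open RawRing ℂ-rawRing public using (_≈_; _+_; _*_; -_) renaming (0# to 0ℂ; 1# to 1ℂ)
open RawSemiringDefs (RawRing.rawSemiring ℂ-rawRing) public using (_^_; sum)
open Polynomials ℂ-rawRing public using (fromℤ; evalℤ)

infixl 6 _-_

_-_ : ℂ → ℂ → ℂ
z - w = z + (- w)

real : ℝ → ℂ
real x = x +i 0ℝ

𝕚 : ℂ
𝕚 = 0ℝ +i 1ℝ

∣_∣² : ℂ → ℝ
∣ z ∣² = re z *ℝ re z +ℝ im z *ℝ im z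

HasSum : (ℕ → ℂ) → ℂ → Set
HasSum u s = ∀ ε → 0ℚ ℚ.< ε →
  ∃[ M ] (∀ n → M ℕ.≤ n → ∣ sum {n} (u ∘ toℕ) - s ∣² <ℝ fromℚ ε *ℝ fromℚ ε)

opaque
  IsExp : ℂ → ℂ → Set
  IsExp w = HasSum (λ n → real (fromℚ (ℚ._/_ 1ℤ (n !) {{ℕ._!≢0 n}})) * w ^ n)

  -- Leibniz: π = 4 (1 - 1/3 + 1/5 - …)
  IsPi : ℝ → Set
  IsPi π = HasSum (λ n → real (fromℚ (((+ 4) ℤ.* (ℤ.- 1ℤ) ℤ.^ n) ℚ./ suc (2 ℕ.* n)))) (real π)

IsNome : ℂ → ℂ → Set
IsNome z q = ∃[ π ] (IsPi π × IsExp (fromℤ (+ 2) * real π * 𝕚 * z) q)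

-- Extended by zero to the integers not prime to n.
record DirichletCharacter (n : ℕ) : Set where
  field
    χ        : ℤ → ℂ
    periodic : ∀ x y → + n ∣ (x ℤ.- y) → χ x ≈ χ y
    χ-*      : ∀ x y → χ (x ℤ.* y) ≈ χ x * χ y
    χ-1      : χ 1ℤ ≈ 1ℂ
    χ-zero   : ∀ x → ¬ Coprime ℤ.∣ x ∣ n → χ x ≈ 0ℂ

private
  opaque
    unfolding _≈ℝ_ fromℚ _+ℝ_ _*ℝ_ -ℝ_

    ≈ℝ-refl : ∀ x → x ≈ℝ x
    ≈ℝ-refl x ε ε>0 = 0 , λ n _ →
      subst (ℚ._< ε) (sym (cong ℚ.∣_∣ (ℚ.+-inverseʳ (seq x n)))) ε>0

    1≈1*1 : 1ℂ ≈ 1ℂ * 1ℂ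
    1≈1*1 = (λ ε ε>0 → 0 , λ _ _ → ε>0) , (λ ε ε>0 → 0 , λ _ _ → ε>0)

    0≈1*0 : 0ℂ ≈ 1ℂ * 0ℂ
    0≈1*0 = (λ ε ε>0 → 0 , λ _ _ → ε>0) , (λ ε ε>0 → 0 , λ _ _ → ε>0)

    0≈0*1 : 0ℂ ≈ 0ℂ * 1ℂ
    0≈0*1 = (λ ε ε>0 → 0 , λ _ _ → ε>0) , (λ ε ε>0 → 0 , λ _ _ → ε>0)

    0≈0*0 : 0ℂ ≈ 0ℂ * 0ℂ
    0≈0*0 = (λ ε ε>0 → 0 , λ _ _ → ε>0) , (λ ε ε>0 → 0 , λ _ _ → ε>0)

  ≈-refl : ∀ {z} → z ≈ z
  ≈-refl {z} = ≈ℝ-refl (re z) , ≈ℝ-refl (im z)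

  coprime-*ˡ : ∀ x y n → Coprime ℤ.∣ x ℤ.* y ∣ n → Coprime ℤ.∣ x ∣ n
  coprime-*ˡ x y n cop {d} (d∣x , d∣n) =
    cop (subst (d ℕ∣.∣_) (sym (ℤ.abs-* x y)) (ℕ∣.∣m⇒∣m*n ℤ.∣ y ∣ d∣x) , d∣n)

  coprime-*ʳ : ∀ x y n → Coprime ℤ.∣ x ℤ.* y ∣ n → Coprime ℤ.∣ y ∣ n
  coprime-*ʳ x y n cop = coprime-*ˡ y x n (subst (λ z → Coprime ℤ.∣ z ∣ n) (ℤ.*-comm x y) cop)

  coprime-* : ∀ x y n → Coprime ℤ.∣ x ∣ n → Coprime ℤ.∣ y ∣ n → Coprime ℤ.∣ x ℤ.* y ∣ n
  coprime-* x y n cx cy {d} (d∣xy , d∣n) = cy (d∣y , d∣n)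
    where
    d⊥x : Coprime d ℤ.∣ x ∣
    d⊥x (e∣d , e∣x) = cx (e∣x , ℕ∣.∣-trans e∣d d∣n)
    d∣y : d ℕ∣.∣ ℤ.∣ y ∣
    d∣y = Coprime.coprime-divisor d⊥x (subst (d ℕ∣.∣_) (ℤ.abs-* x y) d∣xy)

  x≡[x-y]+y : ∀ x y → x ≡ (x ℤ.- y) ℤ.+ y
  x≡[x-y]+y = solve-∀

  y≡x-[x-y] : ∀ x y → y ≡ x ℤ.+ ℤ.- (x ℤ.- y)
  y≡x-[x-y] = solve-∀

  ∣-+ : ∀ d i j → + d ∣ i → + d ∣ j → + d ∣ (i ℤ.+ j)
  ∣-+ d i j d∣i d∣j = ℤˢ.∣⇒∣ᵤ (ℤˢ.∣m∣n⇒∣m+n (ℤˢ.∣ᵤ⇒∣ {+ d} {i} d∣i) (ℤˢ.∣ᵤ⇒∣ {+ d} {j} d∣j))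

  coprime-≡ʳ : ∀ x y n → + n ∣ (x ℤ.- y) → Coprime ℤ.∣ x ∣ n → Coprime ℤ.∣ y ∣ n
  coprime-≡ʳ x y n n∣ cx {d} (d∣y , d∣n) = cx (d∣x , d∣n)
    where
    d∣x : + d ∣ x
    d∣x = subst (+ d ∣_) (sym (x≡[x-y]+y x y)) (∣-+ d (x ℤ.- y) y (ℕ∣.∣-trans d∣n n∣) d∣y)

  coprime-≡ˡ : ∀ x y n → + n ∣ (x ℤ.- y) → Coprime ℤ.∣ y ∣ n → Coprime ℤ.∣ x ∣ n
  coprime-≡ˡ x y n n∣ cy {d} (d∣x , d∣n) = cy (d∣y , d∣n)
    where
    d∣y : + d ∣ y
    d∣y = subst (+ d ∣_) (sym (y≡x-[x-y] x y))
      (∣-+ d x (ℤ.- (x ℤ.- y)) d∣x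
        (subst (d ℕ∣.∣_) (sym (ℤ.∣-i∣≡∣i∣ (x ℤ.- y))) (ℕ∣.∣-trans d∣n n∣)))

trivialCharacter : ∀ n → DirichletCharacter n
trivialCharacter n = record
  { χ = χ₀ ; periodic = per ; χ-* = mult ; χ-1 = one ; χ-zero = van }
  where
  χ₀ : ℤ → ℂ
  χ₀ x = if ⌊ coprime? ℤ.∣ x ∣ n ⌋ then 1ℂ else 0ℂ

  per : ∀ x y → + n ∣ (x ℤ.- y) → χ₀ x ≈ χ₀ y
  per x y n∣ with coprime? ℤ.∣ x ∣ n | coprime? ℤ.∣ y ∣ n
  ... | yes _  | yes _  = ≈-refl
  ... | no _   | no _   = ≈-refl
  ... | yes cx | no ¬cy = contradiction (λ {d} → coprime-≡ʳ x y n n∣ cx {d}) ¬cy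
  ... | no ¬cx | yes cy = contradiction (λ {d} → coprime-≡ˡ x y n n∣ cy {d}) ¬cx

  mult : ∀ x y → χ₀ (x ℤ.* y) ≈ χ₀ x * χ₀ y
  mult x y with coprime? ℤ.∣ x ℤ.* y ∣ n | coprime? ℤ.∣ x ∣ n | coprime? ℤ.∣ y ∣ n
  ... | yes _ | yes _ | yes _ = 1≈1*1
  ... | no _  | yes _ | no _  = 0≈1*0
  ... | no _  | no _  | yes _ = 0≈0*1
  ... | no _  | no _  | no _  = 0≈0*0
  ... | no ¬c | yes cx | yes cy = contradiction (λ {d} → coprime-* x y n cx cy {d}) ¬c
  ... | yes c | no ¬cx | _      = contradiction (λ {d} → coprime-*ˡ x y n c {d}) ¬cx
  ... | yes c | yes _  | no ¬cy = contradiction (λ {d} → coprime-*ʳ x y n c {d}) ¬cy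

  one : χ₀ 1ℤ ≈ 1ℂ
  one with coprime? 1 n
  ... | yes _ = ≈-refl
  ... | no ¬c = contradiction (λ {d} → Coprime.1-coprimeTo n {d}) ¬c

  van : ∀ x → ¬ Coprime ℤ.∣ x ∣ n → χ₀ x ≈ 0ℂ
  van x ¬c with coprime? ℤ.∣ x ∣ n
  ... | yes c = contradiction (λ {d} → c {d}) ¬c
  ... | no _  = ≈-refl

record ℍ : Set where
  constructor mkℍ
  field
    pt    : ℂ
    im>0  : 0ℝ <ℝ im pt
open ℍ

module _ (γ : SL₂ℤ) where
  open SL₂ℤ γ

  automorphy : ℍ → ℂ
  automorphy z = fromℤ c * pt z + fromℤ d

  -- w = γ z, that is (cz + d) w = az + b
  _▹_↦_ : ℍ → ℍ → Set
  _▹_↦_ z w = automorphy z * pt w ≈ fromℤ a * pt z + fromℤ b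

IsHolomorphic : (ℍ → ℂ) → Set
IsHolomorphic F = ∀ z → ∃[ D ] (∀ ε → 0ℚ ℚ.< ε → ∃[ δ ] (0ℚ ℚ.< δ ×
  (∀ w → ∣ pt w - pt z ∣² <ℝ fromℚ δ *ℝ fromℚ δ →
    ∣ F w - F z - D * (pt w - pt z) ∣² ≤ℝ fromℚ ε *ℝ fromℚ ε *ℝ ∣ pt w - pt z ∣²)))

record IsCuspForm (k : ℕ) (Γ : SL₂ℤ → Set) (F : ℍ → ℂ) : Set where
  field
    respects    : ∀ z w → pt z ≈ pt w → F z ≈ F w
    holomorphic : IsHolomorphic F
    modular     : ∀ γ → Γ γ → ∀ z w → γ ▹ z ↦ w → F w ≈ automorphy γ z ^ k * F z
    -- For every γ in SL(2,ℤ), (cz + d)⁻ᵏ F(γz) tends to 0 as Im z tends to ∞.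
    cuspidal    : ∀ γ ε → 0ℚ ℚ.< ε → ∃[ Y ] (∀ z w → fromℚ Y <ℝ im (pt z) → γ ▹ z ↦ w →
                  ∣ F w ∣² <ℝ fromℚ ε *ℝ fromℚ ε *ℝ ∣ automorphy γ z ^ k ∣²)

IsQExpansion : (ℍ → ℂ) → (ℕ → ℂ) → Set
IsQExpansion F a = a 0 ≈ 0ℂ × (∀ z q → IsNome (pt z) q → HasSum (λ m → a m * q ^ m) (F z))

-- The r-th coefficient of T_m F, namely the sum of ε(d) d^(k-1) a(mr/d²) over the
-- common divisors d of m and r.
heckeCoeff : ∀ {n} → ℕ → DirichletCharacter n → (ℕ → ℂ) → ℕ → ℕ → ℂ
heckeCoeff k ε a m r = sum {m} (λ j → term (toℕ j))
  where
  term : ℕ → ℂ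
  term j = let d = suc j in
    if ⌊ d ℕ∣.∣? m ⌋ ∧ ⌊ d ℕ∣.∣? r ⌋
    then DirichletCharacter.χ ε (+ d) * fromℤ (+ d) ^ (k ℕ.∸ 1) * a ((m ℕ./ d) ℕ.* (r ℕ./ d))
    else 0ℂ

-- A normalized eigenform in S_k(Γ_H(n)) with nebentypus ε: an eigenvector of all the
-- operators T_m (m ≥ 1, including m not prime to n) and of the diamond operators.
record NormalizedEigenform (k n : ℕ) (H : ℕ → Set) (ε : DirichletCharacter n) : Set where
  field
    F          : ℍ → ℂ
    isCuspForm : IsCuspForm k Γ[ n , H ] F
    nebentypus : ∀ γ → Γ₀ n γ → ∀ z w → γ ▹ z ↦ w →
                 F w ≈ DirichletCharacter.χ ε (SL₂ℤ.d γ) * automorphy γ z ^ k * F z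
    coeff      : ℕ → ℂ
    qExpansion : IsQExpansion F coeff
    eigen      : ∀ m → 1 ℕ.≤ m → ∃[ c ] (∀ r → heckeCoeff k ε coeff m r ≈ c * coeff r)
    normalized : coeff 1 ≈ 1ℂ

data GeneratedField (S : ℂ → Set) : ℂ → Set where
  gen  : ∀ {x} → S x → GeneratedField S x
  one  : GeneratedField S 1ℂ
  sub  : ∀ {x y} → GeneratedField S x → GeneratedField S y → GeneratedField S (x - y)
  mul  : ∀ {x y} → GeneratedField S x → GeneratedField S y → GeneratedField S (x * y)
  inv  : ∀ {x y} → GeneratedField S x → x * y ≈ 1ℂ → GeneratedField S y
  resp : ∀ {x y} → x ≈ y → GeneratedField S x → GeneratedField S y

CoefficientField : ∀ {k n H ε} → NormalizedEigenform k n H ε → ℂ → Set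
CoefficientField f = GeneratedField (λ x → ∃[ m ] x ≈ NormalizedEigenform.coeff f m)

IsAlgebraic IsAlgebraicInteger : ℂ → Set
IsAlgebraic z        = ∃[ cs ] (Any (λ c → c ≢ 0ℤ) cs × evalℤ cs z ≈ 0ℂ)
IsAlgebraicInteger z = ∃[ cs ] evalℤ (cs ∷ʳ 1ℤ) z ≈ 0ℂ

𝒪 : (ℂ → Set) → ℂ → Set
𝒪 K z = K z × IsAlgebraicInteger z

record IsPrimeAbove (K : ℂ → Set) (p : ℕ) (𝔭 : ℂ → Set) : Set where
  field
    ⊆𝒪      : ∀ x → 𝔭 x → 𝒪 K x
    respects : ∀ x y → x ≈ y → 𝔭 x → 𝔭 y
    p∈𝔭     : 𝔭 (fromℤ (+ p))
    +-closed : ∀ x y → 𝔭 x → 𝔭 y → 𝔭 (x + y)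
    *-closed : ∀ x y → 𝒪 K x → 𝔭 y → 𝔭 (x * y)
    1∉𝔭     : ¬ 𝔭 1ℂ
    prime    : ∀ x y → 𝒪 K x → 𝒪 K y → 𝔭 (x * y) → 𝔭 x ⊎ 𝔭 y

ℚ̄ : Set
ℚ̄ = Σ ℂ IsAlgebraic

-- Sums and products in ℚ̄ are described through their values in ℂ, so that ℚ̄ need
-- not be shown here to be closed under the operations.
record Gal : Set where
  field
    to from  : ℚ̄ → ℚ̄
    to-cong  : ∀ x y → proj₁ x ≈ proj₁ y → proj₁ (to x) ≈ proj₁ (to y)
    to-from  : ∀ x → proj₁ (to (from x)) ≈ proj₁ x
    from-to  : ∀ x → proj₁ (from (to x)) ≈ proj₁ x
    to-1     : ∀ x → proj₁ x ≈ 1ℂ → proj₁ (to x) ≈ 1ℂ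
    to-+     : ∀ x y z → proj₁ z ≈ proj₁ x + proj₁ y → proj₁ (to z) ≈ proj₁ (to x) + proj₁ (to y)
    to-*     : ∀ x y z → proj₁ z ≈ proj₁ x * proj₁ y → proj₁ (to z) ≈ proj₁ (to x) * proj₁ (to y)
open Gal

infix 9 _⟨_⟩

_⟨_⟩ : Gal → ℚ̄ → ℂ
σ ⟨ x ⟩ = proj₁ (to σ x)

IsComposite : Gal → Gal → Gal → Set
IsComposite υ σ τ = ∀ x → υ ⟨ x ⟩ ≈ σ ⟨ to τ x ⟩

IsInertia : (ℂ → Set) → Gal → Set
IsInertia 𝔓 σ = ∀ x → IsAlgebraicInteger (proj₁ x) → 𝔓 (σ ⟨ x ⟩ - proj₁ x)

IsFrobenius : ℕ → (ℂ → Set) → Gal → Set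
IsFrobenius p 𝔓 σ = ∀ x → IsAlgebraicInteger (proj₁ x) → 𝔓 (σ ⟨ x ⟩ - proj₁ x ^ p)

record AlgebraicClosure𝔽 (ℓ : ℕ) : Set₁ where
  field
    commutativeRing : CommutativeRing 0ℓ 0ℓ
  module R = CommutativeRing commutativeRing
  module P = Polynomials R.rawRing
  field
    1≉0                 : ¬ (R.1# R.≈ R.0#)
    inverse             : ∀ x → ¬ (x R.≈ R.0#) → ∃[ y ] (x R.* y) R.≈ R.1#
    characteristic      : P.fromℤ (+ ℓ) R.≈ R.0#
    algebraic           : ∀ x → ∃[ cs ] (Any (λ c → ¬ (+ ℓ ∣ c)) cs × P.evalℤ cs x R.≈ R.0#)
    algebraicallyClosed : ∀ cs → 1 ℕ.≤ length cs → ∃[ x ] P.eval (cs ∷ʳ R.1#) x R.≈ R.0#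

module Representations {ℓ : ℕ} (𝔽̄ : AlgebraicClosure𝔽 ℓ) where
  private
    module 𝔽 = CommutativeRing (AlgebraicClosure𝔽.commutativeRing 𝔽̄)
    module 𝔽^ = RawSemiringDefs (RawRing.rawSemiring 𝔽.rawRing)
    module 𝔽P = Polynomials 𝔽.rawRing

  A : Set
  A = 𝔽.Carrier

  record Mat : Set where
    constructor mat
    field
      m₁₁ m₁₂ m₂₁ m₂₂ : A
  open Mat

  infix  4 _≋_
  infixl 7 _⊡_ _•_ _▷_

  _≋_ : Mat → Mat → Set
  X ≋ Y = m₁₁ X 𝔽.≈ m₁₁ Y × m₁₂ X 𝔽.≈ m₁₂ Y × m₂₁ X 𝔽.≈ m₂₁ Y × m₂₂ X 𝔽.≈ m₂₂ Y

  _⊡_ : Mat → Mat → Mat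
  mat a b c d ⊡ mat a′ b′ c′ d′ = mat
    (a 𝔽.* a′ 𝔽.+ b 𝔽.* c′) (a 𝔽.* b′ 𝔽.+ b 𝔽.* d′)
    (c 𝔽.* a′ 𝔽.+ d 𝔽.* c′) (c 𝔽.* b′ 𝔽.+ d 𝔽.* d′)

  _•_ : A → Mat → Mat
  x • mat a b c d = mat (x 𝔽.* a) (x 𝔽.* b) (x 𝔽.* c) (x 𝔽.* d)

  _▷_ : Mat → A × A → A × A
  mat a b c d ▷ (u , v) = (a 𝔽.* u 𝔽.+ b 𝔽.* v) , (c 𝔽.* u 𝔽.+ d 𝔽.* v)

  I : Mat
  I = mat 𝔽.1# 𝔽.0# 𝔽.0# 𝔽.1#

  trace det : Mat → A
  trace (mat a b c d) = a 𝔽.+ d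
  det   (mat a b c d) = a 𝔽.* d 𝔽.- b 𝔽.* c

  Invertible : Mat → Set
  Invertible X = ∃[ u ] (det X 𝔽.* u) 𝔽.≈ 𝔽.1#

  record Representation : Set where
    field
      ρ          : Gal → Mat
      invertible : ∀ σ → Invertible (ρ σ)
      cong-ρ     : ∀ σ τ → (∀ x → σ ⟨ x ⟩ ≈ τ ⟨ x ⟩) → ρ σ ≋ ρ τ
      homo       : ∀ υ σ τ → IsComposite υ σ τ → ρ υ ≋ (ρ σ ⊡ ρ τ)
      -- Krull topology on the source, discrete topology on the target
      continuous : ∃[ xs ] (∀ σ → All (λ x → σ ⟨ x ⟩ ≈ proj₁ x) xs → ρ σ ≋ I)
  open Representation public using (ρ)

  infix 4 _≅_

  _≅_ : (Gal → Mat) → (Gal → Mat) → Set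
  ρ₁ ≅ ρ₂ = ∃[ P ] (Invertible P × (∀ σ → (P ⊡ ρ₁ σ) ≋ (ρ₂ σ ⊡ P)))

  record IsSubspace (W : A × A → Set) : Set where
    field
      respects : ∀ u v u′ v′ → u 𝔽.≈ u′ → v 𝔽.≈ v′ → W (u , v) → W (u′ , v′)
      0∈W      : W (𝔽.0# , 𝔽.0#)
      +-closed : ∀ u v u′ v′ → W (u , v) → W (u′ , v′) → W ((u 𝔽.+ u′) , (v 𝔽.+ v′))
      *-closed : ∀ x u v → W (u , v) → W ((x 𝔽.* u) , (x 𝔽.* v))

  IsIrreducible : (Gal → Mat) → Set₁
  IsIrreducible ρ = ∀ W → IsSubspace W → (∀ σ v → W v → W (ρ σ ▷ v)) →
    ¬ ((¬ (∀ u v → W (u , v) → u 𝔽.≈ 𝔽.0# × v 𝔽.≈ 𝔽.0#)) × (¬ (∀ v → W v)))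

  -- A direct sum of irreducibles: in dimension two, irreducible or a sum of two characters.
  IsSemisimple : (Gal → Mat) → Set₁
  IsSemisimple ρ = IsIrreducible ρ ⊎
    (Σ (Gal → A) λ α → Σ (Gal → A) λ β → ρ ≅ (λ σ → mat (α σ) 𝔽.0# 𝔽.0# (β σ)))

  -- An embedding of the residue field 𝒪 K / 𝔭 in 𝔽̄, as a ring homomorphism on 𝒪 K
  -- with kernel 𝔭.
  record ResidueEmbedding (K 𝔭 : ℂ → Set) : Set where
    field
      red      : Σ ℂ (𝒪 K) → A
      red-cong : ∀ x y → proj₁ x ≈ proj₁ y → red x 𝔽.≈ red y
      red-1    : ∀ x → proj₁ x ≈ 1ℂ → red x 𝔽.≈ 𝔽.1#
      red-+    : ∀ x y z → proj₁ z ≈ proj₁ x + proj₁ y → red z 𝔽.≈ red x 𝔽.+ red y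
      red-*    : ∀ x y z → proj₁ z ≈ proj₁ x * proj₁ y → red z 𝔽.≈ red x 𝔽.* red y
      kernel⊆  : ∀ x → red x 𝔽.≈ 𝔽.0# → 𝔭 (proj₁ x)
      ⊆kernel  : ∀ x → 𝔭 (proj₁ x) → red x 𝔽.≈ 𝔽.0#

  -- The properties that determine ρ_{g,μ} up to isomorphism, for the embedding ι of the
  -- residue field of μ.
  record IsAttached {k n : ℕ} {H : ℕ → Set} {ε : DirichletCharacter n}
                    (g : NormalizedEigenform k n H ε) {μ : ℂ → Set}
                    (ι : ResidueEmbedding (CoefficientField g) μ)
                    (r : Representation) : Set₁ where
    open ResidueEmbedding ι
    field
      semisimple : IsSemisimple (ρ r)
      unramified : ∀ p → Prime p → ¬ (p ℕ∣.∣ n ℕ.* ℓ) →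
                   ∀ 𝔓 → IsPrimeAbove IsAlgebraic p 𝔓 → ∀ σ → IsInertia 𝔓 σ → ρ r σ ≋ I
      -- x² - (trace) x + (det) is the reduction of x² - a_p x + ε(p) p^(k-1).
      frobenius  : ∀ p → Prime p → ¬ (p ℕ∣.∣ n ℕ.* ℓ) →
                   ∀ 𝔓 → IsPrimeAbove IsAlgebraic p 𝔓 → ∀ σ → IsFrobenius p 𝔓 σ →
                   (∀ x → proj₁ x ≈ NormalizedEigenform.coeff g p → trace (ρ r σ) 𝔽.≈ red x) ×
                   (∀ x → proj₁ x ≈ DirichletCharacter.χ ε (+ p) * fromℤ (+ p) ^ (k ℕ.∸ 1) →
                          det (ρ r σ) 𝔽.≈ red x)

  -- The mod ℓ cyclotomic character: σ ζ = ζ ^ s for all ℓ-th roots of unity ζ.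
  IsCyclotomicCharacter : (Gal → A) → Set
  IsCyclotomicCharacter χ = ∀ σ → ∃[ s ]
    ((∀ ζ → proj₁ ζ ^ ℓ ≈ 1ℂ → σ ⟨ ζ ⟩ ≈ proj₁ ζ ^ s) × χ σ 𝔽.≈ 𝔽P.fromℤ (+ s))

  infix 6 _⊗_^_

  _⊗_^_ : (Gal → Mat) → (Gal → A) → ℕ → Gal → Mat
  (ρ ⊗ χ ^ i) σ = (χ σ 𝔽^.^ i) • ρ σ

SubgroupH : ∀ {n} (N ℓ : ℕ) → DirichletCharacter n → ℤ → (ℂ → Set) → ℕ → Set
SubgroupH N ℓ ε e 𝔩 x =
  0 ℕ.< x × x ℕ.< N ℕ.* ℓ × Coprime x (N ℕ.* ℓ) ×
  ∃[ y ] (IsPowerMod ℓ x e y × 𝔩 (DirichletCharacter.χ ε (+ x) * fromℤ y - 1ℂ))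

{-# OPTIONS --safe #-}

-- A prime 𝔩 above ℓ meets ℤ in ℓℤ, so with ε trivial H consists of the x prime to Nℓ with
-- x^e ≡ 1 (mod ℓ), where e = k - 2 - 2i. A coset γ Γ₁(Nℓ) in Γ_H is determined by the lower right
-- entry of γ modulo Nℓ, hence the index is |H|. By the Chinese remainder theorem |H| is φ(N) times
-- the number of solutions of x^e = 1 in the field with ℓ elements, which is gcd(ℓ - 1, e); for e = 0
-- this gives φ(Nℓ) = φ(N)(ℓ - 1).

module Submission where

open import Defs
open import Data.Bool.Base using (true; false)
open import Data.Integer.Base as ℤ using (ℤ; +_; -[1+_]; 0ℤ; 1ℤ)
import Data.Integer.DivMod as ℤ
import Data.Integer.Divisibility.Signed as ℤ
import Data.Integer.Properties as ℤ
open import Data.Integer.Tactic.RingSolver using (solve-∀)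
open import Data.List.Base using (List; []; _∷_; _++_; map; length; lookup; filter; upTo; cartesianProduct)
import Data.List.Properties as List
open import Data.List.Membership.Propositional using (_∈_)
import Data.List.Membership.Propositional.Properties as ∈
open import Data.List.Membership.Propositional.Properties.WithK using (unique∧set⇒bag)
open import Data.List.Relation.Binary.BagAndSetEquality using (∼bag⇒↭)
open import Data.List.Relation.Binary.Permutation.Propositional using (_↭_)
open import Data.List.Relation.Binary.Permutation.Propositional.Properties using (↭-length)
open import Data.List.Relation.Unary.All as All using (All; []; _∷_)
import Data.List.Relation.Unary.All.Properties as All
open import Data.List.Relation.Unary.AllPairs using ([]; _∷_)
open import Data.List.Relation.Unary.Any as Any using (here; there)
import Data.List.Relation.Unary.Any.Properties as Any
open import Data.List.Relation.Unary.Unique.Propositional using (Unique)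
import Data.List.Relation.Unary.Unique.Propositional.Properties as Unique
open import Data.Nat.Base as ℕ using (ℕ; zero; suc; NonZero; z≤n; s≤s)
open import Data.Nat.Coprimality as Coprime using (Coprime; coprime?)
import Data.Nat.Divisibility as ℕ
import Data.Nat.DivMod as ℕ
import Data.Nat.GCD as ℕ
open import Data.Nat.ListAction using (product)
open import Data.Nat.ListAction.Properties using (product-↭)
open import Data.Nat.Primality as Prime using (Prime)
import Data.Nat.Properties as ℕ
open import Data.Product.Base using (Σ-syntax; ∃-syntax; _×_; _,_; proj₁; proj₂)
open import Data.Sum.Base as Sum using (_⊎_; inj₁; inj₂)
open import Data.Vec.Base as Vec using (Vec; []; _∷_)
open import Function.Base using (_∘_; id)
open import Function.Bundles using (mk⇔)
open import Relation.Binary.PropositionalEquality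
  using (_≡_; _≢_; refl; sym; trans; cong; cong₂; subst; module ≡-Reasoning)
open import Relation.Nullary using (¬_; yes; no; does; contradiction; Dec)
open import Relation.Nullary.Decidable using (map′; _×-dec_; ¬?)
open import Relation.Unary using (Decidable)
open import Data.Fin.Base using (Fin) renaming (zero to fzero; suc to fsuc)
open import Data.Integer.GCD using (gcd)
open import Data.Rational.Base as ℚ using (ℚ; mkℚ; 0ℚ)
import Data.Rational.Properties as ℚ
open import Data.Rational.Unnormalised.Base using (mkℚᵘ; *≡*)

-- Lists without repetition

-- No primitive root modulo ℓ is chosen. Fermat and Bézout replace the exponent by d = gcd(ℓ - 1,
-- e), a divisor of ℓ - 1, and two degree bounds that add up to ℓ - 1 then force the number of d-th
-- roots of unity to be d. Membership in H is membership of a complex number in 𝔩, which cannot be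
-- decided, so H is first identified with a decidable list of natural numbers. The sign of e is lost
-- there: for a unit x, x^e = 1 exactly when x^|e| = 1, and the gcd depends on |e| alone, so all
-- counting is done with natural exponents.

unique-map : ∀ {A B : Set} (f : A → B) {xs} →
             (∀ {x y} → x ∈ xs → y ∈ xs → f x ≡ f y → x ≡ y) →
             Unique xs → Unique (map f xs)
unique-map f inj []         = []
unique-map f inj (x∉xs ∷ u) =
  All.map⁺ (All.tabulate λ y∈xs eq → All.lookup x∉xs y∈xs (inj (here refl) (there y∈xs) eq)) ∷
  unique-map f (λ x∈ y∈ → inj (there x∈) (there y∈)) u

-- Lists without repetition that have the same members agree up to order. A permutation, stronger
-- than equal lengths, is what Euler's theorem needs to compare products. Injectivity is asked on
-- members only, since maps built from remainders are injective only there.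
bijection⇒↭ : ∀ {A B : Set} (f : A → B) {xs ys} → Unique xs → Unique ys →
              (∀ {x} → x ∈ xs → f x ∈ ys) →
              (∀ {x y} → x ∈ xs → y ∈ xs → f x ≡ f y → x ≡ y) →
              (∀ {y} → y ∈ ys → ∃[ x ] (x ∈ xs × f x ≡ y)) →
              map f xs ↭ ys
bijection⇒↭ f {xs} {ys} uxs uys into inj onto =
  ∼bag⇒↭ (unique∧set⇒bag (unique-map f inj uxs) uys (mk⇔ to from))
  where
  to : ∀ {y} → y ∈ map f xs → y ∈ ys
  to y∈ with _ , x∈xs , refl ← ∈.∈-map⁻ f y∈ = into x∈xs

  from : ∀ {y} → y ∈ ys → y ∈ map f xs
  from y∈ys with _ , x∈xs , refl ← onto y∈ys = ∈.∈-map⁺ f x∈xs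

bijection⇒length≡ : ∀ {A B : Set} (f : A → B) {xs ys} → Unique xs → Unique ys →
                    (∀ {x} → x ∈ xs → f x ∈ ys) →
                    (∀ {x y} → x ∈ xs → y ∈ xs → f x ≡ f y → x ≡ y) →
                    (∀ {y} → y ∈ ys → ∃[ x ] (x ∈ xs × f x ≡ y)) →
                    length xs ≡ length ys
bijection⇒length≡ f {xs} uxs uys into inj onto =
  trans (sym (List.length-map f xs)) (↭-length (bijection⇒↭ f uxs uys into inj onto))

length-cong-∈ : ∀ {A : Set} {xs ys : List A} → Unique xs → Unique ys →
                (∀ {x} → x ∈ xs → x ∈ ys) → (∀ {x} → x ∈ ys → x ∈ xs) → length xs ≡ length ys
length-cong-∈ uxs uys to from = ↭-length (∼bag⇒↭ (unique∧set⇒bag uxs uys (mk⇔ to from)))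

length-filter-¬ : ∀ {A : Set} {P : A → Set} (P? : Decidable P) xs →
                  length (filter P? xs) ℕ.+ length (filter (¬? ∘ P?) xs) ≡ length xs
length-filter-¬ P? []       = refl
length-filter-¬ P? (x ∷ xs) with does (P? x)
... | true  = cong suc (length-filter-¬ P? xs)
... | false = trans (ℕ.+-suc (length (filter P? xs)) _) (cong suc (length-filter-¬ P? xs))

∈-filter-upTo⁺ : ∀ {P : ℕ → Set} (P? : Decidable P) {n x} → x ℕ.< n → P x → x ∈ filter P? (upTo n)
∈-filter-upTo⁺ P? x<n = ∈.∈-filter⁺ P? (∈.∈-upTo⁺ x<n)

∈-filter-upTo⁻ : ∀ {P : ℕ → Set} (P? : Decidable P) n {x} → x ∈ filter P? (upTo n) → x ℕ.< n × P x
∈-filter-upTo⁻ P? n x∈ with ∈.∈-filter⁻ P? {xs = upTo n} x∈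
... | x∈n , p = ∈.∈-upTo⁻ x∈n , p

filter-upTo-unique : ∀ {P : ℕ → Set} (P? : Decidable P) n → Unique (filter P? (upTo n))
filter-upTo-unique P? n = Unique.filter⁺ P? (Unique.upTo⁺ n)

length-cartesianProduct : ∀ {A B : Set} (xs : List A) (ys : List B) →
                          length (cartesianProduct xs ys) ≡ length xs ℕ.* length ys
length-cartesianProduct []       ys = refl
length-cartesianProduct (x ∷ xs) ys = begin
  length (map (x ,_) ys ++ cartesianProduct xs ys)
    ≡⟨ List.length-++ (map (x ,_) ys) ⟩
  length (map (x ,_) ys) ℕ.+ length (cartesianProduct xs ys)
    ≡⟨ cong₂ ℕ._+_ (List.length-map (x ,_) ys) (length-cartesianProduct xs ys) ⟩
  length ys ℕ.+ length xs ℕ.* length ys ∎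
  where
  open ≡-Reasoning

-- Congruences

∣-combination : ∀ {d u v s} p q → d ℤ.∣ u → d ℤ.∣ v → s ≡ p ℤ.* u ℤ.+ q ℤ.* v → d ℤ.∣ s
∣-combination p q d∣u d∣v refl = ℤ.∣m∣n⇒∣m+n (ℤ.∣n⇒∣m*n p d∣u) (ℤ.∣n⇒∣m*n q d∣v)

infix 4 _≡_[mod_]

-- A record, so that a and b can be inferred from a proof; their difference alone does not determine
-- them.
record _≡_[mod_] (a b : ℤ) (n : ℕ) : Set where
  constructor mod
  field ∣-difference : + n ℤ.∣ a ℤ.- b
open _≡_[mod_]

mod-dec : ∀ n a b → Dec (a ≡ b [mod n ])
mod-dec n a b = map′ mod ∣-difference (+ n ℤ.∣? a ℤ.- b)

mod-refl : ∀ {n a} → a ≡ a [mod n ]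
mod-refl {a = a} = mod (ℤ.divides 0ℤ (ℤ.+-inverseʳ a))

mod-reflexive : ∀ {n a b} → a ≡ b → a ≡ b [mod n ]
mod-reflexive refl = mod-refl

mod-trans : ∀ {n a b c} → a ≡ b [mod n ] → b ≡ c [mod n ] → a ≡ c [mod n ]
mod-trans {a = a} {b} {c} (mod p) (mod q) = mod (∣-combination 1ℤ 1ℤ p q (lemma a b c))
  where
  lemma : ∀ a b c → a ℤ.- c ≡ 1ℤ ℤ.* (a ℤ.- b) ℤ.+ 1ℤ ℤ.* (b ℤ.- c)
  lemma = solve-∀

mod-sym : ∀ {n a b} → a ≡ b [mod n ] → b ≡ a [mod n ]
mod-sym {a = a} {b} (mod p) = mod (∣-combination (ℤ.- 1ℤ) 0ℤ p p (lemma a b))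
  where
  lemma : ∀ a b → b ℤ.- a ≡ ℤ.- 1ℤ ℤ.* (a ℤ.- b) ℤ.+ 0ℤ ℤ.* (a ℤ.- b)
  lemma = solve-∀

mod-* : ∀ {n a b c d} → a ≡ b [mod n ] → c ≡ d [mod n ] → a ℤ.* c ≡ b ℤ.* d [mod n ]
mod-* {a = a} {b} {c} {d} (mod p) (mod q) = mod (∣-combination c b p q (lemma a b c d))
  where
  lemma : ∀ a b c d → a ℤ.* c ℤ.- b ℤ.* d ≡ c ℤ.* (a ℤ.- b) ℤ.+ b ℤ.* (c ℤ.- d)
  lemma = solve-∀

mod-*ˡ : ∀ {n a b} c → a ≡ b [mod n ] → c ℤ.* a ≡ c ℤ.* b [mod n ]
mod-*ˡ c = mod-* (mod-refl {a = c})

mod-*ʳ : ∀ {n a b} c → a ≡ b [mod n ] → a ℤ.* c ≡ b ℤ.* c [mod n ]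
mod-*ʳ c p = mod-* p (mod-refl {a = c})

mod-^ : ∀ {n a b} e → a ≡ b [mod n ] → a ℤ.^ e ≡ b ℤ.^ e [mod n ]
mod-^ zero    p = mod-refl
mod-^ (suc e) p = mod-* p (mod-^ e p)

mod-∣ : ∀ {m n a b} → m ℕ.∣ n → a ≡ b [mod n ] → a ≡ b [mod m ]
mod-∣ {m} {n} m∣n (mod p) = mod (ℤ.∣-trans (ℤ.∣ᵤ⇒∣ {+ m} {+ n} m∣n) p)

%-mod : ∀ n x .{{_ : NonZero n}} → + (x ℕ.% n) ≡ + x [mod n ]
%-mod n x = mod-sym (mod (ℤ.divides (+ (x ℕ./ n)) (begin
  + x ℤ.- + r                        ≡⟨ cong (λ y → + y ℤ.- + r) (ℕ.m≡m%n+[m/n]*n x n) ⟩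
  + (r ℕ.+ q ℕ.* n) ℤ.- + r          ≡⟨ cong (ℤ._- + r) (ℤ.pos-+ r (q ℕ.* n)) ⟩
  + r ℤ.+ + (q ℕ.* n) ℤ.- + r        ≡⟨ lemma (+ r) (+ (q ℕ.* n)) ⟩
  + (q ℕ.* n)                        ≡⟨ ℤ.pos-* q n ⟩
  + q ℤ.* + n                        ∎)))
  where
  open ≡-Reasoning
  r = x ℕ.% n
  q = x ℕ./ n
  lemma : ∀ a b → a ℤ.+ b ℤ.- a ≡ b
  lemma = solve-∀

%ℕ-mod : ∀ n z .{{_ : NonZero n}} → + (z ℤ.%ℕ n) ≡ z [mod n ]
%ℕ-mod n z = mod-sym (mod (ℤ.divides (z ℤ./ℕ n)
  (trans (cong (ℤ._- + r) (ℤ.a≡a%ℕn+[a/ℕn]*n z n)) (lemma (+ r) _))))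
  where
  r = z ℤ.%ℕ n
  lemma : ∀ a b → a ℤ.+ b ℤ.- a ≡ b
  lemma = solve-∀

-- Since |a - b| is at most the maximum of a and b, it is below n, and the only such multiple of n
-- is 0.
mod-< : ∀ {n a b} → a ℕ.< n → b ℕ.< n → + a ≡ + b [mod n ] → a ≡ b
mod-< {n} {a} {b} a<n b<n (mod p) with ℤ.∣ + a ℤ.- + b ∣ in eq | ℤ.∣⇒∣ᵤ p
... | zero  | _   = ℤ.+-injective (ℤ.i-j≡0⇒i≡j (+ a) (+ b) (ℤ.∣i∣≡0⇒i≡0 eq))
... | suc k | n∣k = contradiction (ℕ.∣⇒≤ n∣k) (ℕ.<⇒≱ (begin-strict
  suc k                ≡⟨ eq ⟨
  ℤ.∣ + a ℤ.- + b ∣    ≡⟨ cong ℤ.∣_∣ (ℤ.m-n≡m⊖n a b) ⟩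
  ℤ.∣ a ℤ.⊖ b ∣        ≤⟨ ℤ.∣m⊝n∣≤m⊔n a b ⟩
  a ℕ.⊔ b              <⟨ ℕ.⊔-lub a<n b<n ⟩
  n                    ∎))
  where open ℕ.≤-Reasoning

-- The inverse is an integer because Bézout over ℕ comes in two forms, one of which yields a
-- negative coefficient of x.
coprime-inverse : ∀ {x n} → Coprime x n → ∃[ u ] u ℤ.* + x ≡ 1ℤ [mod n ]
coprime-inverse {x} {n} c with Coprime.coprime-Bézout c
... | ℕ.Bézout.+- a b eq = + a , mod (ℤ.divides (+ b) (begin
  + a ℤ.* + x ℤ.- 1ℤ          ≡⟨ cong (ℤ._- 1ℤ) (ℤ.pos-* a x) ⟨
  + (a ℕ.* x) ℤ.- 1ℤ          ≡⟨ cong (λ y → + y ℤ.- 1ℤ) eq ⟨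
  + (1 ℕ.+ b ℕ.* n) ℤ.- 1ℤ    ≡⟨ cong (ℤ._- 1ℤ) (ℤ.pos-+ 1 (b ℕ.* n)) ⟩
  1ℤ ℤ.+ + (b ℕ.* n) ℤ.- 1ℤ   ≡⟨ lemma (+ (b ℕ.* n)) ⟩
  + (b ℕ.* n)                 ≡⟨ ℤ.pos-* b n ⟩
  + b ℤ.* + n                 ∎))
  where
  open ≡-Reasoning
  lemma : ∀ z → 1ℤ ℤ.+ z ℤ.- 1ℤ ≡ z
  lemma = solve-∀
... | ℕ.Bézout.-+ a b eq = ℤ.- (+ a) , mod (ℤ.divides (ℤ.- (+ b)) (begin
  ℤ.- (+ a) ℤ.* + x ℤ.- 1ℤ        ≡⟨ lemma (+ a) (+ x) ⟩
  ℤ.- (1ℤ ℤ.+ + a ℤ.* + x)        ≡⟨ cong (λ z → ℤ.- (1ℤ ℤ.+ z)) (ℤ.pos-* a x) ⟨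
  ℤ.- (+ (1 ℕ.+ a ℕ.* x))         ≡⟨ cong (λ y → ℤ.- (+ y)) eq ⟩
  ℤ.- (+ (b ℕ.* n))               ≡⟨ cong ℤ.-_ (ℤ.pos-* b n) ⟩
  ℤ.- (+ b ℤ.* + n)               ≡⟨ ℤ.neg-distribˡ-* (+ b) (+ n) ⟩
  ℤ.- (+ b) ℤ.* + n               ∎))
  where
  open ≡-Reasoning
  lemma : ∀ a x → ℤ.- a ℤ.* x ℤ.- 1ℤ ≡ ℤ.- (1ℤ ℤ.+ a ℤ.* x)
  lemma = solve-∀

-- A common divisor of x and n divides ux and ux - 1, hence 1. As a congruence, coprimality passes
-- between members of a class.
inverse⇒coprime : ∀ {x n} u → u ℤ.* + x ≡ 1ℤ [mod n ] → Coprime x n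
inverse⇒coprime {x} {n} u (mod p) {d} (d∣x , d∣n) = ℕ.∣1⇒≡1 (ℤ.∣⇒∣ᵤ {+ d} {1ℤ}
  (∣-combination u (ℤ.- 1ℤ) (ℤ.∣ᵤ⇒∣ {+ d} {+ x} d∣x) (ℤ.∣-trans (ℤ.∣ᵤ⇒∣ {+ d} {+ n} d∣n) p)
    (lemma u (+ x))))
  where
  lemma : ∀ u x → 1ℤ ≡ u ℤ.* x ℤ.+ ℤ.- 1ℤ ℤ.* (u ℤ.* x ℤ.- 1ℤ)
  lemma = solve-∀

coprime-mod : ∀ {x y n} → + x ≡ + y [mod n ] → Coprime x n → Coprime y n
coprime-mod x≡y c = let u , p = coprime-inverse c in
  inverse⇒coprime u (mod-trans (mod-*ˡ u (mod-sym x≡y)) p)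

coprime-*ˡ : ∀ {x m n} → Coprime x (m ℕ.* n) → Coprime x m
coprime-*ˡ {n = n} c (d∣x , d∣m) = c (d∣x , ℕ.∣m⇒∣m*n n d∣m)

coprime-*ʳ : ∀ {x m n} → Coprime x (m ℕ.* n) → Coprime x n
coprime-*ʳ {m = m} c (d∣x , d∣n) = c (d∣x , ℕ.∣n⇒∣m*n m d∣n)

coprime-* : ∀ {x m n} → Coprime x m → Coprime x n → Coprime x (m ℕ.* n)
coprime-* cm cn {d} (d∣x , d∣mn) = cn (d∣x , Coprime.coprime-divisor
  (λ (e∣d , e∣m) → cm (ℕ.∣-trans e∣d d∣x , e∣m)) d∣mn)

-- The Chinese remainder theorem

module _ {m n : ℕ} (m⊥n : Coprime m n) where

  crt-unique : ∀ {a b} → a ≡ b [mod m ] → a ≡ b [mod n ] → a ≡ b [mod m ℕ.* n ]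
  crt-unique {a} {b} (mod p) (mod q) with ℤ.∣⇒∣ᵤ p | ℤ.∣⇒∣ᵤ q
  ... | m∣ | ℕ.divides k eq = mod (ℤ.∣ᵤ⇒∣ {+ (m ℕ.* n)} {a ℤ.- b}
    (subst (m ℕ.* n ℕ.∣_) (sym eq) (ℕ.*-monoˡ-∣ n
      (Coprime.coprime-divisor {o = k} m⊥n (subst (m ℕ.∣_) (trans eq (ℕ.*-comm k n)) m∣)))))

  crt-solution : ∀ a b → ∃[ x ] (x ≡ a [mod m ] × x ≡ b [mod n ])
  crt-solution a b =
    let u , mod (ℤ.divides k eq) = coprime-inverse m⊥n in
    -- The product um is 0 modulo m and 1 modulo n, so it switches between a and b.
    a ℤ.+ (b ℤ.- a) ℤ.* (u ℤ.* + m) ,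
    mod (ℤ.divides ((b ℤ.- a) ℤ.* u) (lemma₁ a b u (+ m))) ,
    mod (ℤ.divides ((b ℤ.- a) ℤ.* k) (begin
      a ℤ.+ (b ℤ.- a) ℤ.* (u ℤ.* + m) ℤ.- b   ≡⟨ lemma₂ a b (u ℤ.* + m) ⟩
      (b ℤ.- a) ℤ.* (u ℤ.* + m ℤ.- 1ℤ)        ≡⟨ cong ((b ℤ.- a) ℤ.*_) eq ⟩
      (b ℤ.- a) ℤ.* (k ℤ.* + n)               ≡⟨ ℤ.*-assoc (b ℤ.- a) k (+ n) ⟨
      (b ℤ.- a) ℤ.* k ℤ.* + n                 ∎))
    where
    open ≡-Reasoning
    lemma₁ : ∀ a b u m → a ℤ.+ (b ℤ.- a) ℤ.* (u ℤ.* m) ℤ.- a ≡ (b ℤ.- a) ℤ.* u ℤ.* m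
    lemma₁ = solve-∀
    lemma₂ : ∀ a b v → a ℤ.+ (b ℤ.- a) ℤ.* v ℤ.- b ≡ (b ℤ.- a) ℤ.* (v ℤ.- 1ℤ)
    lemma₂ = solve-∀

  crt-count : .{{_ : NonZero m}} .{{_ : NonZero n}} →
              {P Q : ℕ → Set} (P? : Decidable P) (Q? : Decidable Q) →
              length (filter (λ x → P? (x ℕ.% m) ×-dec Q? (x ℕ.% n)) (upTo (m ℕ.* n))) ≡
              length (filter P? (upTo m)) ℕ.* length (filter Q? (upTo n))
  crt-count {P} {Q} P? Q? =
    trans (bijection⇒length≡ residuePair
             (filter-upTo-unique R? (m ℕ.* n))
             (Unique.cartesianProduct⁺ (filter-upTo-unique P? m) (filter-upTo-unique Q? n))
             into injective onto)
          (length-cartesianProduct Ps Qs)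
    where
    instance
      _ = ℕ.m*n≢0 m n
    residuePair : ℕ → ℕ × ℕ
    residuePair x = x ℕ.% m , x ℕ.% n
    R? = λ x → P? (x ℕ.% m) ×-dec Q? (x ℕ.% n)
    Ps = filter P? (upTo m)
    Qs = filter Q? (upTo n)
    Rs = filter R? (upTo (m ℕ.* n))

    into : ∀ {x} → x ∈ Rs → residuePair x ∈ cartesianProduct Ps Qs
    into {x} x∈ = let _ , p , q = ∈-filter-upTo⁻ R? (m ℕ.* n) x∈ in
      ∈.∈-cartesianProduct⁺ (∈-filter-upTo⁺ P? (ℕ.m%n<n x m) p)
                            (∈-filter-upTo⁺ Q? (ℕ.m%n<n x n) q)

    same-residue : ∀ k x y .{{_ : NonZero k}} → x ℕ.% k ≡ y ℕ.% k → + x ≡ + y [mod k ]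
    same-residue k x y eq =
      mod-trans (mod-sym (%-mod k x)) (mod-trans (mod-reflexive (cong +_ eq)) (%-mod k y))

    injective : ∀ {x y} → x ∈ Rs → y ∈ Rs → residuePair x ≡ residuePair y → x ≡ y
    injective {x} {y} x∈ y∈ eq =
      mod-< (proj₁ (∈-filter-upTo⁻ R? (m ℕ.* n) x∈)) (proj₁ (∈-filter-upTo⁻ R? (m ℕ.* n) y∈))
        (crt-unique (same-residue m x y (cong proj₁ eq)) (same-residue n x y (cong proj₂ eq)))

    onto : ∀ {ab} → ab ∈ cartesianProduct Ps Qs → ∃[ x ] (x ∈ Rs × residuePair x ≡ ab)
    onto {a , b} ab∈ =
      x , ∈-filter-upTo⁺ R? (ℤ.n%ℕd<d z (m ℕ.* n)) (subst P (sym ≡a) pa , subst Q (sym ≡b) qb) ,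
      cong₂ _,_ ≡a ≡b
      where
      a∈b∈ = ∈.∈-cartesianProduct⁻ Ps Qs ab∈
      a<m = proj₁ (∈-filter-upTo⁻ P? m (proj₁ a∈b∈))
      pa  = proj₂ (∈-filter-upTo⁻ P? m (proj₁ a∈b∈))
      b<n = proj₁ (∈-filter-upTo⁻ Q? n (proj₂ a∈b∈))
      qb  = proj₂ (∈-filter-upTo⁻ Q? n (proj₂ a∈b∈))
      solution = crt-solution (+ a) (+ b)
      z = proj₁ solution
      x = z ℤ.%ℕ (m ℕ.* n)
      x≡z : + x ≡ z [mod m ℕ.* n ]
      x≡z = %ℕ-mod (m ℕ.* n) z
      ≡a : x ℕ.% m ≡ a
      ≡a = mod-< (ℕ.m%n<n x m) a<m
        (mod-trans (%-mod m x) (mod-trans (mod-∣ (ℕ.m∣m*n n) x≡z) (proj₁ (proj₂ solution))))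
      ≡b : x ℕ.% n ≡ b
      ≡b = mod-< (ℕ.m%n<n x n) b<n
        (mod-trans (%-mod n x) (mod-trans (mod-∣ (ℕ.n∣m*n m) x≡z) (proj₂ (proj₂ solution))))

-- Roots of polynomials modulo a prime

-- A vector of n coefficients, constant term first, stands for a monic polynomial of degree n.
evalMonic : ∀ {n} → Vec ℤ n → ℤ → ℤ
evalMonic []       x = 1ℤ
evalMonic (c ∷ cs) x = c ℤ.+ x ℤ.* evalMonic cs x

-- Synthetic division by x - a.
quotient : ∀ {n} → Vec ℤ (suc n) → ℤ → Vec ℤ n
quotient (c ∷ [])          a = []
quotient (c ∷ cs@(_ ∷ _)) a = evalMonic cs a ∷ quotient cs a

-- Holds for every a; modulo p it becomes the factor theorem as soon as a is a root modulo p.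
evalMonic-quotient : ∀ {n} (v : Vec ℤ (suc n)) a x →
                     evalMonic v x ℤ.- evalMonic v a ≡ (x ℤ.- a) ℤ.* evalMonic (quotient v a) x
evalMonic-quotient (c ∷ []) a x = lemma c a x
  where
  lemma : ∀ c a x → c ℤ.+ x ℤ.* 1ℤ ℤ.- (c ℤ.+ a ℤ.* 1ℤ) ≡ (x ℤ.- a) ℤ.* 1ℤ
  lemma = solve-∀
evalMonic-quotient (c ∷ cs@(_ ∷ _)) a x = begin
  c ℤ.+ x ℤ.* f x ℤ.- (c ℤ.+ a ℤ.* f a)
    ≡⟨ lemma₁ c x a (f x) (f a) ⟩
  (x ℤ.- a) ℤ.* f a ℤ.+ x ℤ.* (f x ℤ.- f a)
    ≡⟨ cong (λ y → (x ℤ.- a) ℤ.* f a ℤ.+ x ℤ.* y) (evalMonic-quotient cs a x) ⟩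
  (x ℤ.- a) ℤ.* f a ℤ.+ x ℤ.* ((x ℤ.- a) ℤ.* q)
    ≡⟨ lemma₂ x a (f a) q ⟩
  (x ℤ.- a) ℤ.* (f a ℤ.+ x ℤ.* q) ∎
  where
  open ≡-Reasoning
  f = evalMonic cs
  q = evalMonic (quotient cs a) x
  lemma₁ : ∀ c x a u v → c ℤ.+ x ℤ.* u ℤ.- (c ℤ.+ a ℤ.* v) ≡ (x ℤ.- a) ℤ.* v ℤ.+ x ℤ.* (u ℤ.- v)
  lemma₁ = solve-∀
  lemma₂ : ∀ x a v q → (x ℤ.- a) ℤ.* v ℤ.+ x ℤ.* ((x ℤ.- a) ℤ.* q) ≡ (x ℤ.- a) ℤ.* (v ℤ.+ x ℤ.* q)
  lemma₂ = solve-∀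

prime-∣-* : ∀ {p} → Prime p → ∀ a b → + p ℤ.∣ a ℤ.* b → + p ℤ.∣ a ⊎ + p ℤ.∣ b
prime-∣-* {p} pr a b p∣ab = Sum.map (ℤ.∣ᵤ⇒∣ {+ p} {a}) (ℤ.∣ᵤ⇒∣ {+ p} {b})
  (Prime.euclidsLemma ℤ.∣ a ∣ ℤ.∣ b ∣ pr (subst (p ℕ.∣_) (ℤ.abs-* a b) (ℤ.∣⇒∣ᵤ p∣ab)))

prime⇒∤1 : ∀ {p} → Prime p → ¬ (+ p ℤ.∣ 1ℤ)
prime⇒∤1 pr p∣1 = Prime.¬prime[1] (subst Prime (ℕ.∣1⇒≡1 (ℤ.∣⇒∣ᵤ p∣1)) pr)

-- Divide by x - r for the first root r. Any other root s has s - r prime to p, because distinct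
-- numbers below p are incongruent, so s is a root of the quotient.
length-roots≤degree : ∀ {p n} → Prime p → (v : Vec ℤ n) → ∀ {rs} → Unique rs → All (ℕ._< p) rs →
                      All (λ r → + p ℤ.∣ evalMonic v (+ r)) rs → length rs ℕ.≤ n
length-roots≤degree pr v [] _ _ = z≤n
length-roots≤degree pr [] (_ ∷ _) _ (p∣1 ∷ _) = contradiction p∣1 (prime⇒∤1 pr)
length-roots≤degree {p} pr v@(_ ∷ _) {r ∷ rs} (r∉rs ∷ u) (r<p ∷ rs<p) (root ∷ roots) =
  s≤s (length-roots≤degree pr (quotient v (+ r)) u rs<p (All.tabulate root-of-quotient))
  where
  root-of-quotient : ∀ {s} → s ∈ rs → + p ℤ.∣ evalMonic (quotient v (+ r)) (+ s)
  root-of-quotient {s} s∈rs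
    with prime-∣-* pr (+ s ℤ.- + r) (evalMonic (quotient v (+ r)) (+ s))
           (subst (+ p ℤ.∣_) (evalMonic-quotient v (+ r) (+ s)) (ℤ.∣m∣n⇒∣m-n (All.lookup roots s∈rs) root))
  ... | inj₁ p∣s-r = contradiction (sym (mod-< (All.lookup rs<p s∈rs) r<p (mod p∣s-r))) (All.lookup r∉rs s∈rs)
  ... | inj₂ p∣q   = p∣q

shift : ∀ {n} k → Vec ℤ n → Vec ℤ (k ℕ.+ n)
shift k v = Vec.replicate k 0ℤ Vec.++ v

evalMonic-shift : ∀ {n} k (v : Vec ℤ n) x → evalMonic (shift k v) x ≡ x ℤ.^ k ℤ.* evalMonic v x
evalMonic-shift zero    v x = sym (ℤ.*-identityˡ (evalMonic v x))
evalMonic-shift (suc k) v x = begin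
  0ℤ ℤ.+ x ℤ.* evalMonic (shift k v) x       ≡⟨ ℤ.+-identityˡ _ ⟩
  x ℤ.* evalMonic (shift k v) x              ≡⟨ cong (x ℤ.*_) (evalMonic-shift k v x) ⟩
  x ℤ.* (x ℤ.^ k ℤ.* evalMonic v x)          ≡⟨ ℤ.*-assoc x (x ℤ.^ k) (evalMonic v x) ⟨
  x ℤ.* x ℤ.^ k ℤ.* evalMonic v x            ∎
  where open ≡-Reasoning

-- x ^ suc d - 1
power-1 : ∀ d → Vec ℤ (suc (d ℕ.+ 0))
power-1 d = ℤ.- 1ℤ ∷ shift d []

evalMonic-power-1 : ∀ d x → evalMonic (power-1 d) x ≡ x ℤ.^ suc d ℤ.- 1ℤ
evalMonic-power-1 d x = begin
  ℤ.- 1ℤ ℤ.+ x ℤ.* evalMonic (shift d []) x    ≡⟨ cong (λ y → ℤ.- 1ℤ ℤ.+ x ℤ.* y) (evalMonic-shift d [] x) ⟩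
  ℤ.- 1ℤ ℤ.+ x ℤ.* (x ℤ.^ d ℤ.* 1ℤ)            ≡⟨ lemma x (x ℤ.^ d) ⟩
  x ℤ.* x ℤ.^ d ℤ.- 1ℤ                         ∎
  where
  open ≡-Reasoning
  lemma : ∀ x y → ℤ.- 1ℤ ℤ.+ x ℤ.* (y ℤ.* 1ℤ) ≡ x ℤ.* y ℤ.- 1ℤ
  lemma = solve-∀

-- 1 + y + y² + … + yᵐ with y = x ^ suc d
geometric : ∀ d m → Vec ℤ (m ℕ.* suc d)
geometric d zero    = []
geometric d (suc m) = 1ℤ ∷ shift d (geometric d m)

evalMonic-geometric : ∀ d m x → (x ℤ.^ suc d ℤ.- 1ℤ) ℤ.* evalMonic (geometric d m) x ≡
                                x ℤ.^ (suc m ℕ.* suc d) ℤ.- 1ℤ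
evalMonic-geometric d zero x = trans (ℤ.*-identityʳ _)
  (cong (λ e → x ℤ.^ suc e ℤ.- 1ℤ) (sym (ℕ.+-identityʳ d)))
evalMonic-geometric d (suc m) x = begin
  (x ℤ.* y ℤ.- 1ℤ) ℤ.* (1ℤ ℤ.+ x ℤ.* evalMonic (shift d (geometric d m)) x)
    ≡⟨ cong (λ z → (x ℤ.* y ℤ.- 1ℤ) ℤ.* (1ℤ ℤ.+ x ℤ.* z)) (evalMonic-shift d (geometric d m) x) ⟩
  (x ℤ.* y ℤ.- 1ℤ) ℤ.* (1ℤ ℤ.+ x ℤ.* (y ℤ.* g))
    ≡⟨ lemma₁ x y g ⟩
  x ℤ.* y ℤ.- 1ℤ ℤ.+ x ℤ.* y ℤ.* ((x ℤ.* y ℤ.- 1ℤ) ℤ.* g)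
    ≡⟨ cong (λ z → x ℤ.* y ℤ.- 1ℤ ℤ.+ x ℤ.* y ℤ.* z) (evalMonic-geometric d m x) ⟩
  x ℤ.* y ℤ.- 1ℤ ℤ.+ x ℤ.* y ℤ.* (x ℤ.^ (suc m ℕ.* suc d) ℤ.- 1ℤ)
    ≡⟨ lemma₂ (x ℤ.* y) _ ⟩
  x ℤ.^ suc d ℤ.* x ℤ.^ (suc m ℕ.* suc d) ℤ.- 1ℤ
    ≡⟨ cong (ℤ._- 1ℤ) (ℤ.^-distribˡ-+-* x (suc d) (suc m ℕ.* suc d)) ⟨
  x ℤ.^ (suc (suc m) ℕ.* suc d) ℤ.- 1ℤ ∎
  where
  open ≡-Reasoning
  y = x ℤ.^ d
  g = evalMonic (geometric d m) x
  lemma₁ : ∀ x y g → (x ℤ.* y ℤ.- 1ℤ) ℤ.* (1ℤ ℤ.+ x ℤ.* (y ℤ.* g)) ≡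
                     x ℤ.* y ℤ.- 1ℤ ℤ.+ x ℤ.* y ℤ.* ((x ℤ.* y ℤ.- 1ℤ) ℤ.* g)
  lemma₁ = solve-∀
  lemma₂ : ∀ w z → w ℤ.- 1ℤ ℤ.+ w ℤ.* (z ℤ.- 1ℤ) ≡ w ℤ.* z ℤ.- 1ℤ
  lemma₂ = solve-∀

-- Torsion in (ℤ/n)*

-- Runs over 0, ..., n - 1, the range of remainders, whereas `φ` runs over 1, ..., n.
residues : ℕ → List ℕ
residues n = filter (λ x → coprime? x n) (upTo n)

residues-unique : ∀ n → Unique (residues n)
residues-unique n = filter-upTo-unique (λ x → coprime? x n) n

∈-residues⁺ : ∀ {n x} → x ℕ.< n → Coprime x n → x ∈ residues n
∈-residues⁺ {n} = ∈-filter-upTo⁺ (λ x → coprime? x n)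

∈-residues⁻ : ∀ n {x} → x ∈ residues n → x ℕ.< n × Coprime x n
∈-residues⁻ n = ∈-filter-upTo⁻ (λ x → coprime? x n) n

coprime-cancel : ∀ {x n} → Coprime x n → ∀ {a b} → + x ℤ.* a ≡ + x ℤ.* b [mod n ] → a ≡ b [mod n ]
coprime-cancel {x} {n} c {a} {b} xa≡xb = let u , ux≡1 = coprime-inverse c in
  mod-trans (mod-sym (undo u ux≡1 a)) (mod-trans (mod-*ˡ u xa≡xb) (undo u ux≡1 b))
  where
  undo : ∀ u → u ℤ.* + x ≡ 1ℤ [mod n ] → ∀ a → u ℤ.* (+ x ℤ.* a) ≡ a [mod n ]
  undo u ux≡1 a = mod-trans (mod-reflexive (sym (ℤ.*-assoc u (+ x) a)))
    (mod-trans (mod-*ʳ a ux≡1) (mod-reflexive (ℤ.*-identityˡ a)))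

-- Multiplication by x permutes the residues prime to n; compare the products.
euler : ∀ {x n} .{{_ : NonZero n}} → Coprime x n → (+ x) ℤ.^ length (residues n) ≡ 1ℤ [mod n ]
euler {x} {n} c = coprime-cancel (product-coprime (residues n) (λ r∈ → proj₂ (∈-residues⁻ n r∈)))
  (mod-trans (mod-reflexive (ℤ.*-comm (+ product (residues n)) _))
    (mod-trans (mod-sym (product-multiples (residues n)))
      (mod-reflexive (trans (cong +_ (product-↭ (bijection⇒↭ multiply unique unique into injective onto)))
                            (sym (ℤ.*-identityʳ _))))))
  where
  unique = residues-unique n

  multiply : ℕ → ℕ
  multiply r = (x ℕ.* r) ℕ.% n

  multiply-mod : ∀ r → + multiply r ≡ + x ℤ.* + r [mod n ]
  multiply-mod r = mod-trans (%-mod n (x ℕ.* r)) (mod-reflexive (ℤ.pos-* x r))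

  product-multiples : ∀ rs → + product (map multiply rs) ≡ (+ x) ℤ.^ length rs ℤ.* + product rs [mod n ]
  product-multiples []       = mod-refl
  product-multiples (r ∷ rs) =
    mod-trans (mod-reflexive (ℤ.pos-* (multiply r) _))
      (mod-trans (mod-* (multiply-mod r) (product-multiples rs))
        (mod-reflexive (trans (lemma (+ x) (+ r) _ (+ product rs))
          (cong (+ x ℤ.* (+ x) ℤ.^ length rs ℤ.*_) (sym (ℤ.pos-* r (product rs)))))))
    where
    lemma : ∀ x r y z → x ℤ.* r ℤ.* (y ℤ.* z) ≡ x ℤ.* y ℤ.* (r ℤ.* z)
    lemma = solve-∀

  product-coprime : ∀ rs → (∀ {r} → r ∈ rs → Coprime r n) → Coprime (product rs) n
  product-coprime []       _  = Coprime.1-coprimeTo n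
  product-coprime (r ∷ rs) cs = Coprime.sym (coprime-* (Coprime.sym (cs (here refl)))
    (Coprime.sym (product-coprime rs (λ r∈ → cs (there r∈)))))

  into : ∀ {r} → r ∈ residues n → multiply r ∈ residues n
  into {r} r∈ = ∈-residues⁺ (ℕ.m%n<n (x ℕ.* r) n)
    (coprime-mod (mod-sym (%-mod n (x ℕ.* r)))
      (Coprime.sym (coprime-* (Coprime.sym c) (Coprime.sym (proj₂ (∈-residues⁻ n r∈))))))

  injective : ∀ {r s} → r ∈ residues n → s ∈ residues n → multiply r ≡ multiply s → r ≡ s
  injective {r} {s} r∈ s∈ eq =
    mod-< (proj₁ (∈-residues⁻ n r∈)) (proj₁ (∈-residues⁻ n s∈))
      (coprime-cancel c (mod-trans (mod-sym (multiply-mod r))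
        (mod-trans (mod-reflexive (cong +_ eq)) (multiply-mod s))))

  onto : ∀ {s} → s ∈ residues n → ∃[ r ] (r ∈ residues n × multiply r ≡ s)
  onto {s} s∈ = r , ∈-residues⁺ r<n r⊥n , mod-< (ℕ.m%n<n (x ℕ.* r) n) s<n
    (mod-trans (multiply-mod r) xr≡s)
    where
    s<n = proj₁ (∈-residues⁻ n s∈)
    s⊥n = proj₂ (∈-residues⁻ n s∈)
    u = proj₁ (coprime-inverse c)
    v = proj₁ (coprime-inverse s⊥n)
    -- With u and v the inverses of x and s, the preimage of s is us, and vx is an inverse of it.
    r = (u ℤ.* + s) ℤ.%ℕ n
    r<n = ℤ.n%ℕd<d (u ℤ.* + s) n
    lemma₁ : ∀ x u s → x ℤ.* (u ℤ.* s) ≡ u ℤ.* x ℤ.* s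
    lemma₁ = solve-∀
    lemma₂ : ∀ x v r → v ℤ.* x ℤ.* r ≡ v ℤ.* (x ℤ.* r)
    lemma₂ = solve-∀
    xr≡s : + x ℤ.* + r ≡ + s [mod n ]
    xr≡s = mod-trans (mod-*ˡ (+ x) (%ℕ-mod n (u ℤ.* + s)))
      (mod-trans (mod-reflexive (lemma₁ (+ x) u (+ s)))
        (mod-trans (mod-*ʳ (+ s) (proj₂ (coprime-inverse c))) (mod-reflexive (ℤ.*-identityˡ (+ s)))))
    r⊥n : Coprime r n
    r⊥n = inverse⇒coprime (v ℤ.* + x) (mod-trans (mod-reflexive (lemma₂ (+ x) v (+ r)))
      (mod-trans (mod-*ˡ v xr≡s) (proj₂ (coprime-inverse s⊥n))))

mod-^-∣ : ∀ {x n d e} → d ℕ.∣ e → x ℤ.^ d ≡ 1ℤ [mod n ] → x ℤ.^ e ≡ 1ℤ [mod n ]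
mod-^-∣ {x} {d = d} (ℕ.divides k refl) p =
  mod-trans (mod-reflexive (trans (cong (x ℤ.^_) (ℕ.*-comm k d)) (sym (ℤ.^-*-assoc x d k))))
    (mod-trans (mod-^ k p) (mod-reflexive (ℤ.^-zeroˡ k)))

-- Subtraction of exponents without negative powers: x^d = x^d x^f = x^(d+f) = 1. Bézout over ℕ
-- presents the gcd as such a d.
mod-^-cancel : ∀ {x n d e f g} → e ℕ.∣ f → x ℤ.^ e ≡ 1ℤ [mod n ] →
               g ℕ.∣ d ℕ.+ f → x ℤ.^ g ≡ 1ℤ [mod n ] → x ℤ.^ d ≡ 1ℤ [mod n ]
mod-^-cancel {x} {d = d} {f = f} e∣f pe g∣d+f pg =
  mod-trans (mod-reflexive (sym (ℤ.*-identityʳ (x ℤ.^ d))))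
    (mod-trans (mod-*ˡ (x ℤ.^ d) (mod-sym (mod-^-∣ {x} e∣f pe)))
      (mod-trans (mod-reflexive (sym (ℤ.^-distribˡ-+-* x d f))) (mod-^-∣ {x} g∣d+f pg)))

mod-^-gcd : ∀ {x n} a b → x ℤ.^ a ≡ 1ℤ [mod n ] → x ℤ.^ b ≡ 1ℤ [mod n ] →
            x ℤ.^ ℕ.gcd a b ≡ 1ℤ [mod n ]
mod-^-gcd {x} a b pa pb with ℕ.Bézout.identity (ℕ.gcd-GCD a b)
... | ℕ.Bézout.+- i j eq = mod-^-cancel {x} (ℕ.n∣m*n j) pb (subst (a ℕ.∣_) (sym eq) (ℕ.n∣m*n i)) pa
... | ℕ.Bézout.-+ i j eq = mod-^-cancel {x} (ℕ.n∣m*n i) pa (subst (b ℕ.∣_) (sym eq) (ℕ.n∣m*n j)) pb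

Torsion : ℕ → ℕ → ℕ → Set
Torsion n e x = (+ x) ℤ.^ e ≡ 1ℤ [mod n ]

torsion? : ∀ n e → Decidable (Torsion n e)
torsion? n e x = mod-dec n ((+ x) ℤ.^ e) 1ℤ

-- Roots of unity modulo a prime

module _ {p : ℕ} (pr : Prime p) where

  private instance
    _ = Prime.prime⇒nonZero pr

  length-residues-prime : length (residues p) ≡ p ℕ.∸ 1
  length-residues-prime = trans
    (length-cong-∈ (residues-unique p)
      (Unique.map⁺ ℕ.suc-injective (Unique.upTo⁺ (p ℕ.∸ 1))) to from)
    (trans (List.length-map suc (upTo (p ℕ.∸ 1))) (List.length-upTo (p ℕ.∸ 1)))
    where
    to : ∀ {x} → x ∈ residues p → x ∈ map suc (upTo (p ℕ.∸ 1))
    to {x} x∈ with x | ∈-residues⁻ p x∈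
    ... | zero  | _   , c = contradiction (subst Prime (Coprime.0-coprimeTo-m⇒m≡1 c) pr) Prime.¬prime[1]
    ... | suc y | y<p , _ = ∈.∈-map⁺ suc (∈.∈-upTo⁺ (ℕ.∸-monoˡ-≤ 1 y<p))

    from : ∀ {x} → x ∈ map suc (upTo (p ℕ.∸ 1)) → x ∈ residues p
    from x∈ with y , y∈ , refl ← ∈.∈-map⁻ suc x∈ =
      ∈-residues⁺ y<p (Coprime.sym (Coprime.prime⇒coprime pr y<p))
      where
      y<p : suc y ℕ.< p
      y<p = subst (suc (suc y) ℕ.≤_) (ℕ.suc-pred p) (s≤s (∈.∈-upTo⁻ y∈))

  fermat : ∀ {x} → Coprime x p → Torsion p (p ℕ.∸ 1) x
  fermat {x} c = subst (λ e → Torsion p e x) length-residues-prime (euler c)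

  -- The p - 1 residues are the roots of x ^ (p - 1) - 1 = (x ^ d - 1) · (1 + x ^ d + …), and each
  -- factor has at most as many roots as its degree, hence exactly as many.
  count-torsion-∣ : ∀ d m → p ℕ.∸ 1 ≡ suc m ℕ.* suc d →
                    length (filter (torsion? p (suc d)) (residues p)) ≡ suc d
  count-torsion-∣ d m p-1≡ = ℕ.≤-antisym
    (subst (length As ℕ.≤_) (cong suc (ℕ.+-identityʳ d)) (bound T? (power-1 d) power-1-root))
    (ℕ.+-cancelʳ-≤ (m ℕ.* suc d) (suc d) (length As) (begin
      suc m ℕ.* suc d             ≡⟨ p-1≡ ⟨
      p ℕ.∸ 1                     ≡⟨ length-residues-prime ⟨
      length (residues p)         ≡⟨ length-filter-¬ T? (residues p) ⟨
      length As ℕ.+ length Bs     ≤⟨ ℕ.+-monoʳ-≤ (length As) (bound (¬? ∘ T?) (geometric d m) geometric-root) ⟩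
      length As ℕ.+ m ℕ.* suc d   ∎))
    where
    open ℕ.≤-Reasoning
    T? = torsion? p (suc d)
    As = filter T? (residues p)
    Bs = filter (¬? ∘ T?) (residues p)

    bound : ∀ {n} {P : ℕ → Set} (P? : Decidable P) (v : Vec ℤ n) →
            (∀ {x} → Coprime x p → P x → + p ℤ.∣ evalMonic v (+ x)) →
            length (filter P? (residues p)) ℕ.≤ n
    bound P? v root = length-roots≤degree pr v
      (Unique.filter⁺ P? (residues-unique p))
      (All.tabulate λ x∈ → proj₁ (∈-residues⁻ p (proj₁ (∈.∈-filter⁻ P? {xs = residues p} x∈))))
      (All.tabulate λ x∈ → let x∈res , px = ∈.∈-filter⁻ P? {xs = residues p} x∈ in
        root (proj₂ (∈-residues⁻ p x∈res)) px)

    power-1-root : ∀ {x} → Coprime x p → Torsion p (suc d) x → + p ℤ.∣ evalMonic (power-1 d) (+ x)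
    power-1-root {x} _ (mod p∣) = subst (+ p ℤ.∣_) (sym (evalMonic-power-1 d (+ x))) p∣

    geometric-root : ∀ {x} → Coprime x p → ¬ Torsion p (suc d) x → + p ℤ.∣ evalMonic (geometric d m) (+ x)
    -- By Fermat p divides the product of the two factors; not dividing the first, it divides the
    -- second.
    geometric-root {x} c ¬t = Sum.[ (λ p∣ → contradiction (mod p∣) ¬t) , id ]
      (prime-∣-* pr ((+ x) ℤ.^ suc d ℤ.- 1ℤ) (evalMonic (geometric d m) (+ x))
        (subst (+ p ℤ.∣_) (sym (evalMonic-geometric d m (+ x)))
          (∣-difference (subst (λ e → Torsion p e x) p-1≡ (fermat c)))))

  -- As x^(p-1) = 1 by Fermat, x^e = 1 is equivalent to x^d = 1 with d = gcd(p - 1, e), and d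
  -- divides p - 1. For e = 0 this d is p - 1.
  count-torsion : ∀ e → length (filter (λ x → coprime? x p ×-dec torsion? p e x) (upTo p)) ≡ ℕ.gcd (p ℕ.∸ 1) e
  count-torsion e = trans
    (length-cong-∈ (filter-upTo-unique C×T? p)
      (Unique.filter⁺ (torsion? p d) (residues-unique p)) to from)
    (count d (ℕ.gcd[m,n]∣m (p ℕ.∸ 1) e))
    where
    d = ℕ.gcd (p ℕ.∸ 1) e
    C×T? = λ x → coprime? x p ×-dec torsion? p e x

    to : ∀ {x} → x ∈ filter C×T? (upTo p) → x ∈ filter (torsion? p d) (residues p)
    to {x} x∈ = let x<p , c , t = ∈-filter-upTo⁻ C×T? p x∈ in
      ∈.∈-filter⁺ (torsion? p d) (∈-residues⁺ x<p c)
        (mod-^-gcd {+ x} (p ℕ.∸ 1) e (fermat c) t)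

    from : ∀ {x} → x ∈ filter (torsion? p d) (residues p) → x ∈ filter C×T? (upTo p)
    from {x} x∈ =
      let x∈res , t = ∈.∈-filter⁻ (torsion? p d) {xs = residues p} x∈
          x<p , c   = ∈-residues⁻ p x∈res
      in ∈-filter-upTo⁺ C×T? x<p (c , mod-^-∣ {+ x} (ℕ.gcd[m,n]∣n (p ℕ.∸ 1) e) t)

    p-1≢0 : p ℕ.∸ 1 ≢ 0
    p-1≢0 eq = Prime.¬prime[1] (subst Prime (trans (sym (ℕ.suc-pred p)) (cong suc eq)) pr)

    count : ∀ d → d ℕ.∣ p ℕ.∸ 1 → length (filter (torsion? p d) (residues p)) ≡ d
    count zero    0∣p-1                         = contradiction (ℕ.0∣⇒≡0 0∣p-1) p-1≢0
    count (suc d) (ℕ.divides zero    p-1≡0)     = contradiction p-1≡0 p-1≢0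
    count (suc d) (ℕ.divides (suc m) p-1≡)      = count-torsion-∣ d m p-1≡

-- Units modulo np that are roots of unity modulo p

module _ {n p : ℕ} (pr : Prime p) (n⊥p : Coprime n p) .{{_ : NonZero n}} where

  private instance
    _ = Prime.prime⇒nonZero pr

  torsionResidues : ℕ → List ℕ
  torsionResidues e = filter (λ x → coprime? x (n ℕ.* p) ×-dec torsion? p e x) (upTo (n ℕ.* p))

  -- The condition splits: being a unit modulo n concerns x mod n, being a root of unity concerns x
  -- mod p.
  length-torsionResidues : ∀ e → length (torsionResidues e) ≡ length (residues n) ℕ.* ℕ.gcd (p ℕ.∸ 1) e
  length-torsionResidues e = trans
    (cong length (List.filter-≐ _ _ (to , from) (upTo (n ℕ.* p))))
    (trans (crt-count n⊥p (λ x → coprime? x n) (λ x → coprime? x p ×-dec torsion? p e x))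
           (cong (length (residues n) ℕ.*_) (count-torsion pr e)))
    where
    to : ∀ {x} → Coprime x (n ℕ.* p) × Torsion p e x →
         Coprime (x ℕ.% n) n × Coprime (x ℕ.% p) p × Torsion p e (x ℕ.% p)
    to {x} (c , t) =
      coprime-mod (mod-sym (%-mod n x)) (coprime-*ˡ c) ,
      coprime-mod (mod-sym (%-mod p x)) (coprime-*ʳ {m = n} c) ,
      mod-trans (mod-^ e (%-mod p x)) t
    from : ∀ {x} → Coprime (x ℕ.% n) n × Coprime (x ℕ.% p) p × Torsion p e (x ℕ.% p) →
           Coprime x (n ℕ.* p) × Torsion p e x
    from {x} (cn , cp , t) =
      coprime-* (coprime-mod (%-mod n x) cn) (coprime-mod (%-mod p x) cp) ,
      mod-trans (mod-^ e (mod-sym (%-mod p x))) t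

  -- The index formula cleared of its denominator. The same count at exponent 0, where every unit
  -- qualifies, evaluates the totient.
  length-torsionResidues-φ : ∀ e → length (torsionResidues e) ℕ.* (p ℕ.∸ 1) ≡ φ (n ℕ.* p) ℕ.* ℕ.gcd (p ℕ.∸ 1) e
  length-torsionResidues-φ e = begin
    length (torsionResidues e) ℕ.* (p ℕ.∸ 1)
      ≡⟨ cong (ℕ._* (p ℕ.∸ 1)) (length-torsionResidues e) ⟩
    length (residues n) ℕ.* ℕ.gcd (p ℕ.∸ 1) e ℕ.* (p ℕ.∸ 1)
      ≡⟨ swap (length (residues n)) _ _ ⟩
    length (residues n) ℕ.* (p ℕ.∸ 1) ℕ.* ℕ.gcd (p ℕ.∸ 1) e
      ≡⟨ cong (ℕ._* ℕ.gcd (p ℕ.∸ 1) e) φ≡ ⟨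
    φ (n ℕ.* p) ℕ.* ℕ.gcd (p ℕ.∸ 1) e ∎
    where
    open ≡-Reasoning
    swap : ∀ a b c → a ℕ.* b ℕ.* c ≡ a ℕ.* c ℕ.* b
    swap a b c = trans (ℕ.*-assoc a b c) (trans (cong (a ℕ.*_) (ℕ.*-comm b c)) (sym (ℕ.*-assoc a c b)))

    C? = λ x → coprime? x (n ℕ.* p)
    C×T? = λ x → coprime? x (n ℕ.* p) ×-dec torsion? p 0 x

    -- The ranges 1, ..., np and 0, ..., np - 1 differ in np and 0, neither of which is prime to np
    -- because np is not 1.
    np≢1 : n ℕ.* p ≢ 1
    np≢1 np≡1 = Prime.¬prime[1] (subst Prime (ℕ.m*n≡1⇒n≡1 n p np≡1) pr)

    to : ∀ {x} → x ∈ filter C? (map suc (upTo (n ℕ.* p))) → x ∈ torsionResidues 0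
    to x∈ with ∈.∈-filter⁻ C? {xs = map suc (upTo (n ℕ.* p))} x∈
    ... | x∈map , c with y , y∈ , refl ← ∈.∈-map⁻ suc x∈map =
      ∈-filter-upTo⁺ C×T? (ℕ.≤∧≢⇒< (∈.∈-upTo⁻ y∈) λ y+1≡np →
        np≢1 (c (subst (n ℕ.* p ℕ.∣_) (sym y+1≡np) ℕ.∣-refl , ℕ.∣-refl))) (c , mod-refl)

    from : ∀ {x} → x ∈ torsionResidues 0 → x ∈ filter C? (map suc (upTo (n ℕ.* p)))
    from {x} x∈ with x | ∈-filter-upTo⁻ C×T? (n ℕ.* p) x∈
    ... | zero  | _    , c , _ = contradiction (Coprime.0-coprimeTo-m⇒m≡1 c) np≢1
    ... | suc y | y<np , c , _ = ∈.∈-filter⁺ C? (∈.∈-map⁺ suc (∈.∈-upTo⁺ (ℕ.<⇒≤ y<np))) c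

    φ≡ : φ (n ℕ.* p) ≡ length (residues n) ℕ.* (p ℕ.∸ 1)
    φ≡ = begin
      φ (n ℕ.* p)
        ≡⟨ length-cong-∈ (Unique.filter⁺ C? (Unique.map⁺ ℕ.suc-injective (Unique.upTo⁺ (n ℕ.* p))))
                         (filter-upTo-unique C×T? (n ℕ.* p)) to from ⟩
      length (torsionResidues 0)
        ≡⟨ length-torsionResidues 0 ⟩
      length (residues n) ℕ.* ℕ.gcd (p ℕ.∸ 1) 0
        ≡⟨ cong (length (residues n) ℕ.*_) (ℕ.gcd-identityʳ (p ℕ.∸ 1)) ⟩
      length (residues n) ℕ.* (p ℕ.∸ 1) ∎

-- Cosets of Γ₁

lookup-injective : ∀ {A : Set} {xs : List A} → Unique xs → ∀ {i j} → lookup xs i ≡ lookup xs j → i ≡ j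
lookup-injective (x∉xs ∷ u) {fzero}  {fzero}  eq = refl
lookup-injective (x∉xs ∷ u) {fzero}  {fsuc j} eq = contradiction eq (All.lookup x∉xs (∈.∈-lookup j))
lookup-injective (x∉xs ∷ u) {fsuc i} {fzero}  eq = contradiction (sym eq) (All.lookup x∉xs (∈.∈-lookup i))
lookup-injective (x∉xs ∷ u) {fsuc i} {fsuc j} eq = cong fsuc (lookup-injective u eq)

module _ {n : ℕ} (ρ γ : SL₂ℤ) (n∣cρ : + n ℤ.∣ SL₂ℤ.c ρ) (n∣cγ : + n ℤ.∣ SL₂ℤ.c γ) where
  open SL₂ℤ ρ
  open SL₂ℤ γ renaming (a to a′; b to b′; c to c′; d to d′; det≡1 to det′≡1)

  -- Modulo n both c and c′ vanish, so the lower right entry of the product is ad′, which is ad,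
  -- which is det ρ = 1.
  same-d⇒Γ₁ : d′ ≡ d [mod n ] → Γ₁ n (ρ ⁻¹ · γ)
  same-d⇒Γ₁ (mod n∣) =
    ℤ.∣⇒∣ᵤ {+ n} {SL₂ℤ.c (ρ ⁻¹ · γ)} (∣-combination (ℤ.- a′) a n∣cρ n∣cγ (lemma₁ a a′ c c′)) ,
    1 , refl ,
    ℤ.∣⇒∣ᵤ {+ n} {SL₂ℤ.d (ρ ⁻¹ · γ) ℤ.- 1ℤ} (∣-combination (b ℤ.- b′) a n∣cρ n∣
      (trans (cong (λ z → ℤ.- c ℤ.* b′ ℤ.+ a ℤ.* d′ ℤ.- z) (sym det≡1)) (lemma₂ a b c d b′ d′)))
    where
    lemma₁ : ∀ a a′ c c′ → ℤ.- c ℤ.* a′ ℤ.+ a ℤ.* c′ ≡ ℤ.- a′ ℤ.* c ℤ.+ a ℤ.* c′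
    lemma₁ = solve-∀
    lemma₂ : ∀ a b c d b′ d′ → ℤ.- c ℤ.* b′ ℤ.+ a ℤ.* d′ ℤ.- (a ℤ.* d ℤ.- b ℤ.* c) ≡
                               (b ℤ.- b′) ℤ.* c ℤ.+ a ℤ.* (d′ ℤ.- d)
    lemma₂ = solve-∀

  -- Modulo n membership says ad′ = 1; multiplying by d, the inverse of a, gives d′ = d.
  Γ₁⇒same-d : Γ₁ n (ρ ⁻¹ · γ) → d′ ≡ d [mod n ]
  Γ₁⇒same-d (_ , _ , refl , n∣) = mod (∣-combination d (d ℤ.* b′ ℤ.- d′ ℤ.* b)
    (ℤ.∣ᵤ⇒∣ {+ n} {SL₂ℤ.d (ρ ⁻¹ · γ) ℤ.- 1ℤ} n∣) n∣cρ (begin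
      d′ ℤ.- d                                    ≡⟨ cong (ℤ._- d) (ℤ.*-identityʳ d′) ⟨
      d′ ℤ.* 1ℤ ℤ.- d                             ≡⟨ cong (λ z → d′ ℤ.* z ℤ.- d) det≡1 ⟨
      d′ ℤ.* (a ℤ.* d ℤ.- b ℤ.* c) ℤ.- d          ≡⟨ lemma a b c d b′ d′ ⟩
      d ℤ.* (ℤ.- c ℤ.* b′ ℤ.+ a ℤ.* d′ ℤ.- 1ℤ) ℤ.+ (d ℤ.* b′ ℤ.- d′ ℤ.* b) ℤ.* c ∎))
    where
    open ≡-Reasoning
    lemma : ∀ a b c d b′ d′ → d′ ℤ.* (a ℤ.* d ℤ.- b ℤ.* c) ℤ.- d ≡
      d ℤ.* (ℤ.- c ℤ.* b′ ℤ.+ a ℤ.* d′ ℤ.- 1ℤ) ℤ.+ (d ℤ.* b′ ℤ.- d′ ℤ.* b) ℤ.* c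
    lemma = solve-∀

-- An inverse u of x with ux - 1 = kn is precisely an upper row (u, k) of determinant 1.
withLowerRow : ∀ {n x} → Coprime x n → ∃[ γ ] (SL₂ℤ.c γ ≡ + n × SL₂ℤ.d γ ≡ + x)
withLowerRow {n} {x} cop with u , mod (ℤ.divides k eq) ← coprime-inverse cop =
  mkSL₂ u k (+ n) (+ x) (trans (cong (λ z → u ℤ.* + x ℤ.- z) (sym eq)) (lemma (u ℤ.* + x))) , refl , refl
  where
  lemma : ∀ z → z ℤ.- (z ℤ.- 1ℤ) ≡ 1ℤ
  lemma = solve-∀

-- One representative for each x in H, with lower row (n, x). Members of H lie below n, so distinct
-- ones are distinct classes and no coset is met twice; 1 in H gives the inclusion of Γ₁.
Γ-index : ∀ {n H} {xs : List ℕ} → Unique xs → (∀ {x} → H x → x ∈ xs) → (∀ {x} → x ∈ xs → H x) →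
          (∀ {x} → H x → x ℕ.< n) → (∀ {x} → H x → Coprime x n) → H 1 →
          HasIndex Γ[ n , H ] (Γ₁ n) (length xs)
Γ-index {n} {H} {xs} u H⇒∈ ∈⇒H H⇒< H⇒coprime H1 = record
  { subset = λ { γ (n∣c , _ , refl , n∣d-1) → n∣c , 1 , H1 , n∣d-1 }
  ; rep    = rep
  ; rep∈G  = λ j → ℤ.∣⇒∣ᵤ {+ n} {SL₂ℤ.c (rep j)} (n∣rep-c j) , lookup xs j , H-lookup j ,
                   ℤ.∣⇒∣ᵤ {+ n} {SL₂ℤ.d (rep j) ℤ.- + lookup xs j} (∣-difference (rep-d j))
  ; coset  = coset
  }
  where
  H-lookup : ∀ j → H (lookup xs j)
  H-lookup j = ∈⇒H (∈.∈-lookup j)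

  lift : ∀ j → ∃[ γ ] (SL₂ℤ.c γ ≡ + n × SL₂ℤ.d γ ≡ + lookup xs j)
  lift j = withLowerRow (H⇒coprime (H-lookup j))

  rep : Fin (length xs) → SL₂ℤ
  rep j = proj₁ (lift j)

  n∣rep-c : ∀ j → + n ℤ.∣ SL₂ℤ.c (rep j)
  n∣rep-c j = ℤ.∣-reflexive (sym (proj₁ (proj₂ (lift j))))

  rep-d : ∀ j → SL₂ℤ.d (rep j) ≡ + lookup xs j [mod n ]
  rep-d j = mod-reflexive (proj₂ (proj₂ (lift j)))

  coset : ∀ γ → Γ[ n , H ] γ → ∃[ j ] (Γ₁ n (rep j ⁻¹ · γ) × (∀ j′ → Γ₁ n (rep j′ ⁻¹ · γ) → j′ ≡ j))
  coset γ (n∣c , x , Hx , n∣d-x) = j , same-d⇒Γ₁ (rep j) γ (n∣rep-c j) n∣c′ (mod-trans d≡ (mod-sym (rep-d j))) ,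
    λ j′ inΓ₁ → lookup-injective u (mod-< (H⇒< (H-lookup j′)) (H⇒< (H-lookup j))
      (mod-trans (mod-sym (rep-d j′))
        (mod-trans (mod-sym (Γ₁⇒same-d (rep j′) γ (n∣rep-c j′) n∣c′ inΓ₁)) d≡)))
    where
    j = Any.index (H⇒∈ Hx)
    n∣c′ = ℤ.∣ᵤ⇒∣ {+ n} {SL₂ℤ.c γ} n∣c
    d≡ : SL₂ℤ.d γ ≡ + lookup xs j [mod n ]
    d≡ = mod-trans (mod (ℤ.∣ᵤ⇒∣ {+ n} {SL₂ℤ.d γ ℤ.- + x} n∣d-x))
      (mod-reflexive (cong +_ (Any.lookup-index (H⇒∈ Hx))))

-- Rational integers in a prime above p

-- Written with denominator 1 outright, whereas `z / 1` is first reduced by a gcd.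
int : ℤ → ℚ
int z = mkℚ z 0 (Coprime.sym (Coprime.1-coprimeTo ℤ.∣ z ∣))

/1≡int : ∀ z → z ℚ./ 1 ≡ int z
/1≡int z = ℚ.↥p/↧p≡p (int z)

int-+ : ∀ y z → int y ℚ.+ int z ≡ int (y ℤ.+ z)
int-+ y z = trans (cong (ℚ._/ 1) (cong₂ ℤ._+_ (ℤ.*-identityʳ y) (ℤ.*-identityʳ z))) (/1≡int (y ℤ.+ z))

int-* : ∀ y z → int y ℚ.* int z ≡ int (y ℤ.* z)
int-* y z = /1≡int (y ℤ.* z)

int-neg : ∀ z → ℚ.- int z ≡ int (ℤ.- z)
int-neg z = begin
  ℚ.- int z
    ≡⟨ ℚ.↥p/↧p≡p (ℚ.- int z) ⟨
  ℚ.numerator (ℚ.- int z) ℚ./ suc (ℚ.denominator-1 (ℚ.- int z))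
    ≡⟨ cong₂ (λ a b → a ℚ./ suc b) (ℚ.↥-neg (int z)) (denominator z) ⟩
  (ℤ.- z) ℚ./ 1
    ≡⟨ /1≡int (ℤ.- z) ⟩
  int (ℤ.- z) ∎
  where
  open ≡-Reasoning
  denominator : ∀ z → ℚ.denominator-1 (ℚ.- int z) ≡ 0
  denominator (+ 0)       = refl
  denominator (+ (suc _)) = refl
  denominator -[1+ _ ]    = refl

-- Complex numbers represented by constant sequences can be compared and computed with exactly,
-- so that the congruence properties of the operations of ℝ are not needed.
record IsInt (z : ℂ) (m : ℤ) : Set where
  field
    re-const : ∀ n → ℝ.seq (ℂ.re z) n ≡ int m
    im-const : ∀ n → ℝ.seq (ℂ.im z) n ≡ 0ℚ
open IsInt

IsInt-subst : ∀ {z m m′} → m ≡ m′ → IsInt z m → IsInt z m′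
IsInt-subst refl p = p

opaque
  unfolding _≈ℝ_ fromℚ _+ℝ_ _*ℝ_ -ℝ_

  ≈ℝ-pointwise : ∀ x y → (∀ n → ℝ.seq x n ≡ ℝ.seq y n) → x ≈ℝ y
  ≈ℝ-pointwise x y eq ε ε>0 = 0 , λ n _ → subst (ℚ._< ε)
    (sym (cong ℚ.∣_∣ (trans (cong (ℚ._- ℝ.seq y n) (eq n)) (ℚ.+-inverseʳ (ℝ.seq y n))))) ε>0

  IsInt-0 : IsInt 0ℂ 0ℤ
  IsInt-0 = record { re-const = λ _ → refl ; im-const = λ _ → refl }

  IsInt-1 : IsInt 1ℂ 1ℤ
  IsInt-1 = record { re-const = λ _ → refl ; im-const = λ _ → refl }

  IsInt-+ : ∀ {z w a b} → IsInt z a → IsInt w b → IsInt (z + w) (a ℤ.+ b)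
  IsInt-+ {a = a} {b} p q = record
    { re-const = λ n → trans (cong₂ ℚ._+_ (re-const p n) (re-const q n)) (int-+ a b)
    ; im-const = λ n → cong₂ ℚ._+_ (im-const p n) (im-const q n)
    }

  IsInt-neg : ∀ {z a} → IsInt z a → IsInt (- z) (ℤ.- a)
  IsInt-neg {a = a} p = record
    { re-const = λ n → trans (cong ℚ.-_ (re-const p n)) (int-neg a)
    ; im-const = λ n → cong ℚ.-_ (im-const p n)
    }

  IsInt-* : ∀ {z w a b} → IsInt z a → IsInt w b → IsInt (z * w) (a ℤ.* b)
  IsInt-* {a = a} {b} p q = record
    { re-const = λ n → trans
        (cong₂ ℚ._-_ (cong₂ ℚ._*_ (re-const p n) (re-const q n)) (cong₂ ℚ._*_ (im-const p n) (im-const q n)))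
        (trans (ℚ.+-identityʳ (int a ℚ.* int b)) (int-* a b))
    ; im-const = λ n → trans
        (cong₂ ℚ._+_ (cong₂ ℚ._*_ (re-const p n) (im-const q n)) (cong₂ ℚ._*_ (im-const p n) (re-const q n)))
        (cong₂ ℚ._+_ (ℚ.*-zeroʳ (int a)) (ℚ.*-zeroˡ (int b)))
    }

IsInt-≈ : ∀ {z w m} → IsInt z m → IsInt w m → z ≈ w
IsInt-≈ {z} {w} p q =
  ≈ℝ-pointwise (ℂ.re z) (ℂ.re w) (λ n → trans (re-const p n) (sym (re-const q n))) ,
  ≈ℝ-pointwise (ℂ.im z) (ℂ.im w) (λ n → trans (im-const p n) (sym (im-const q n)))

IsInt-fromℕ : ∀ n → IsInt (fromℤ (+ n)) (+ n)
IsInt-fromℕ zero    = IsInt-0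
IsInt-fromℕ (suc n) = IsInt-+ IsInt-1 (IsInt-fromℕ n)

IsInt-fromℤ : ∀ m → IsInt (fromℤ m) m
IsInt-fromℤ (+ n)    = IsInt-fromℕ n
IsInt-fromℤ -[1+ n ] = IsInt-neg (IsInt-fromℕ (suc n))

fromℤ-algebraicInteger : ∀ m → IsAlgebraicInteger (fromℤ m)
-- The monic polynomial X - m; its leading 1 is appended by `IsAlgebraicInteger`.
fromℤ-algebraicInteger m = ℤ.- m ∷ [] ,
  IsInt-≈ (IsInt-subst (lemma m)
            (IsInt-+ (IsInt-fromℤ (ℤ.- m)) (IsInt-* (IsInt-fromℤ m)
              (IsInt-+ (IsInt-fromℤ 1ℤ) (IsInt-* (IsInt-fromℤ m) IsInt-0)))))
          IsInt-0
  where
  lemma : ∀ m → ℤ.- m ℤ.+ m ℤ.* (1ℤ ℤ.+ m ℤ.* 0ℤ) ≡ 0ℤ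
  lemma = solve-∀

-- The field is generated with 1 and subtraction, so 0 arises as 1 - 1 and n + 1 as n - (0 - 1).
fromℕ∈GeneratedField : ∀ {S} n → GeneratedField S (fromℤ (+ n))
fromℕ∈GeneratedField zero    = resp (IsInt-≈ (IsInt-+ IsInt-1 (IsInt-neg IsInt-1)) IsInt-0) (sub one one)
fromℕ∈GeneratedField (suc n) =
  resp (IsInt-≈ (IsInt-subst (lemma (+ n))
                  (IsInt-+ (IsInt-fromℕ n) (IsInt-neg (IsInt-+ IsInt-0 (IsInt-neg IsInt-1)))))
                (IsInt-fromℕ (suc n)))
       (sub (fromℕ∈GeneratedField n) (sub (fromℕ∈GeneratedField zero) one))
  where
  lemma : ∀ z → z ℤ.+ ℤ.- (0ℤ ℤ.+ ℤ.- 1ℤ) ≡ 1ℤ ℤ.+ z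
  lemma = solve-∀

fromℤ∈GeneratedField : ∀ {S} m → GeneratedField S (fromℤ m)
fromℤ∈GeneratedField (+ n)    = fromℕ∈GeneratedField n
fromℤ∈GeneratedField -[1+ n ] =
  resp (IsInt-≈ (IsInt-+ IsInt-0 (IsInt-neg (IsInt-fromℕ (suc n)))) (IsInt-fromℤ -[1+ n ]))
       (sub (fromℕ∈GeneratedField zero) (fromℕ∈GeneratedField (suc n)))

module _ {S p 𝔭} (pr : Prime p) (above : IsPrimeAbove (GeneratedField S) p 𝔭) where
  open IsPrimeAbove above

  private instance
    _ = Prime.prime⇒nonZero pr

  fromℤ∈𝒪 : ∀ m → 𝒪 (GeneratedField S) (fromℤ m)
  fromℤ∈𝒪 m = fromℤ∈GeneratedField m , fromℤ-algebraicInteger m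

  multiple∈𝔭 : ∀ {z m} → IsInt z m → + p ℤ.∣ m → 𝔭 z
  multiple∈𝔭 {z} z≈m (ℤ.divides k refl) =
    respects (fromℤ k * fromℤ (+ p)) z (IsInt-≈ (IsInt-* (IsInt-fromℤ k) (IsInt-fromℤ (+ p))) z≈m)
      (*-closed (fromℤ k) (fromℤ (+ p)) (fromℤ∈𝒪 k) p∈𝔭)

  -- Otherwise 1 = um - kp would lie in 𝔭.
  unit∉𝔭 : ∀ {z m} u → IsInt z m → u ℤ.* m ≡ 1ℤ [mod p ] → ¬ 𝔭 z
  unit∉𝔭 {z} {m} u z≈m (mod (ℤ.divides k eq)) z∈𝔭 = 1∉𝔭
    (respects (fromℤ u * z + fromℤ (ℤ.- k) * fromℤ (+ p)) 1ℂ
      (IsInt-≈ (IsInt-subst um-kp≡1 (IsInt-+ (IsInt-* (IsInt-fromℤ u) z≈m)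
                                            (IsInt-* (IsInt-fromℤ (ℤ.- k)) (IsInt-fromℤ (+ p))))) IsInt-1)
      (+-closed _ _ (*-closed (fromℤ u) z (fromℤ∈𝒪 u) z∈𝔭)
                    (*-closed (fromℤ (ℤ.- k)) (fromℤ (+ p)) (fromℤ∈𝒪 (ℤ.- k)) p∈𝔭)))
    where
    lemma₁ : ∀ v k p → v ℤ.+ ℤ.- k ℤ.* p ≡ v ℤ.- k ℤ.* p
    lemma₁ = solve-∀
    lemma₂ : ∀ v → v ℤ.- (v ℤ.- 1ℤ) ≡ 1ℤ
    lemma₂ = solve-∀
    um-kp≡1 : u ℤ.* m ℤ.+ ℤ.- k ℤ.* + p ≡ 1ℤ
    um-kp≡1 = trans (lemma₁ (u ℤ.* m) k (+ p)) (trans (cong (λ z → u ℤ.* m ℤ.- z) (sym eq)) (lemma₂ (u ℤ.* m)))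

  -- A nonzero remainder of m modulo the prime p would be invertible. Deciding on the remainder
  -- keeps the argument constructive.
  ∈𝔭⇒∣ : ∀ {z} m → IsInt z m → 𝔭 z → m ≡ 0ℤ [mod p ]
  ∈𝔭⇒∣ m z≈m z∈𝔭 with m ℤ.%ℕ p | %ℕ-mod p m | ℤ.n%ℕd<d m p
  ... | zero  | 0≡m | _   = mod-sym 0≡m
  ... | suc r | r≡m | r<p =
    let u , ur≡1 = coprime-inverse (Coprime.sym (Coprime.prime⇒coprime pr r<p))
    in contradiction z∈𝔭 (unit∉𝔭 u z≈m (mod-trans (mod-*ˡ u (mod-sym r≡m)) ur≡1))

-- The subgroup H

trivialCharacter-1 : ∀ {n x} → Coprime x n → IsInt (DirichletCharacter.χ (trivialCharacter n) (+ x)) 1ℤ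
trivialCharacter-1 {n} {x} c with coprime? x n
... | yes _ = IsInt-1
... | no ¬c = contradiction (λ {d} → c {d}) ¬c

-- For negative e the value y is an inverse of x^|e|, and the inverse of 1 is 1.
isPowerMod-torsion : ∀ {p x y} e → IsPowerMod p x e y → y ≡ 1ℤ [mod p ] → Torsion p ℤ.∣ e ∣ x
isPowerMod-torsion {p} {x} {y} (+ e)    p∣ y≡1 =
  mod-trans (mod-sym (mod (ℤ.∣ᵤ⇒∣ {+ p} {y ℤ.- (+ x) ℤ.^ e} p∣))) y≡1
isPowerMod-torsion {p} {x} {y} -[1+ e ] p∣ y≡1 =
  mod-trans (mod-reflexive (sym (ℤ.*-identityˡ ((+ x) ℤ.^ suc e))))
    (mod-trans (mod-*ʳ ((+ x) ℤ.^ suc e) (mod-sym y≡1)) (mod (ℤ.∣ᵤ⇒∣ {+ p} {y ℤ.* (+ x) ℤ.^ suc e ℤ.- 1ℤ} p∣)))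

torsion-isPowerMod : ∀ {p x} e → Torsion p ℤ.∣ e ∣ x → IsPowerMod p x e 1ℤ
torsion-isPowerMod {p} {x} (+ e)    t = ℤ.∣⇒∣ᵤ {+ p} {1ℤ ℤ.- (+ x) ℤ.^ e} (∣-difference (mod-sym t))
torsion-isPowerMod {p} {x} -[1+ e ] t = ℤ.∣⇒∣ᵤ {+ p} {1ℤ ℤ.* (+ x) ℤ.^ suc e ℤ.- 1ℤ}
  (∣-difference (mod-trans (mod-reflexive (ℤ.*-identityˡ ((+ x) ℤ.^ suc e))) t))

module _ {S ℓ N 𝔩} (pr : Prime ℓ) (above : IsPrimeAbove (GeneratedField S) ℓ 𝔩)
         (N⊥ℓ : Coprime N ℓ) .{{_ : NonZero N}} (e : ℤ) where

  private
    H = SubgroupH N ℓ (trivialCharacter N) e 𝔩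
    T? = λ x → coprime? x (N ℕ.* ℓ) ×-dec torsion? ℓ ℤ.∣ e ∣ x

    value : ∀ {x} y → Coprime x (N ℕ.* ℓ) →
            IsInt (DirichletCharacter.χ (trivialCharacter N) (+ x) * fromℤ y - 1ℂ) (1ℤ ℤ.* y ℤ.- 1ℤ)
    value y c = IsInt-+ (IsInt-* (trivialCharacter-1 (coprime-*ˡ c)) (IsInt-fromℤ y)) (IsInt-neg IsInt-1)

  H⇒torsion : ∀ {x} → H x → x ∈ torsionResidues pr N⊥ℓ ℤ.∣ e ∣
  H⇒torsion {x} (_ , x<Nℓ , c , y , xᵉ≡y , ∈𝔩) = ∈-filter-upTo⁺ T? x<Nℓ
    ((λ {d} → c {d}) , isPowerMod-torsion e xᵉ≡y
      (mod (subst (+ ℓ ℤ.∣_) (lemma y) (∣-difference (∈𝔭⇒∣ pr above _ (value {x} y c) ∈𝔩)))))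
    where
    lemma : ∀ y → 1ℤ ℤ.* y ℤ.- 1ℤ ℤ.- 0ℤ ≡ y ℤ.- 1ℤ
    lemma = solve-∀

  torsion⇒H : ∀ {x} → x ∈ torsionResidues pr N⊥ℓ ℤ.∣ e ∣ → H x
  torsion⇒H {x} x∈ with x | ∈-filter-upTo⁻ T? (N ℕ.* ℓ) x∈
  -- H demands 0 < x: 0 is prime to Nℓ only if Nℓ = 1, which would make ℓ = 1.
  ... | zero  | _ , c , _ =
    contradiction (subst Prime (ℕ.m*n≡1⇒n≡1 N ℓ (Coprime.0-coprimeTo-m⇒m≡1 c)) pr) Prime.¬prime[1]
  ... | suc y | x<Nℓ , c , t = ℕ.z<s , x<Nℓ , (λ {d} → c {d}) , 1ℤ , torsion-isPowerMod e t ,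
    multiple∈𝔭 pr above (value {suc y} 1ℤ c) (ℤ.divides 0ℤ refl)

-- The index formula

/-cross : ∀ a b d .{{_ : NonZero d}} → a ℤ.* + d ≡ b → a ℚ./ 1 ≡ b ℚ./ d
/-cross a b (suc d) eq = ℚ.fromℚᵘ-cong {mkℚᵘ a 0} {mkℚᵘ b d} (*≡* (trans eq (sym (ℤ.*-identityʳ b))))

theorem5p2 :
  (ℓ N k : ℕ) → Prime ℓ → (5≤ℓ : 5 ℕ.≤ ℓ) → 0 ℕ.< N → Coprime N ℓ → 2 ℕ.< k →
  (𝔽̄ : AlgebraicClosure𝔽 ℓ) → let open Representations 𝔽̄ in
  (f : NormalizedEigenform k N (units N) (trivialCharacter N)) →
  (𝔩 : ℂ → Set) → IsPrimeAbove (CoefficientField f) ℓ 𝔩 →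
  (ι : ResidueEmbedding (CoefficientField f) 𝔩) →
  (r : Representation) → IsAttached f ι r → IsIrreducible (ρ r) →
  (i : ℕ) → i ℕ.≤ ℓ ℕ.∸ 1 →
  let e = + k ℤ.- + 2 ℤ.- + 2 ℤ.* + i
      H = SubgroupH N ℓ (trivialCharacter N) e 𝔩
  in
  (Σ[ ε₂ ∈ DirichletCharacter (N ℕ.* ℓ) ]
   Σ[ f₂ ∈ NormalizedEigenform 2 (N ℕ.* ℓ) H ε₂ ]
   Σ[ 𝔩₂ ∈ (ℂ → Set) ]
   Σ[ ι₂ ∈ ResidueEmbedding (CoefficientField f₂) 𝔩₂ ]
   Σ[ r₂ ∈ Representation ]
   Σ[ χ ∈ (Gal → A) ]
     (IsPrimeAbove (CoefficientField f₂) ℓ 𝔩₂ × IsAttached f₂ ι₂ r₂ ×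
      IsCyclotomicCharacter χ × ρ r ≅ ρ r₂ ⊗ χ ^ i)) →
  ∃[ m ] (HasIndex Γ[ N ℕ.* ℓ , H ] (Γ₁ (N ℕ.* ℓ)) m ×
          (+ m ℚ./ 1) ≡
            ℚ._/_ (+ φ (N ℕ.* ℓ) ℤ.* gcd (+ ℓ ℤ.- + 1) e) (ℓ ℕ.∸ 1) {{pred-nonZero 5≤ℓ}})
theorem5p2 ℓ N k pr 5≤ℓ 0<N N⊥ℓ 2<k 𝔽̄ f 𝔩 above ι r attached irr i i≤ _ =
  length H-list ,
  Γ-index (filter-upTo-unique _ (N ℕ.* ℓ)) (H⇒torsion pr above N⊥ℓ e) (torsion⇒H pr above N⊥ℓ e)
    (λ Hx → proj₁ (proj₂ Hx)) (λ Hx → proj₁ (proj₂ (proj₂ Hx))) (torsion⇒H pr above N⊥ℓ e 1∈H-list) ,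
  /-cross (+ length H-list) _ (ℓ ℕ.∸ 1) {{pred-nonZero 5≤ℓ}} (begin
    + length H-list ℤ.* + (ℓ ℕ.∸ 1)
      ≡⟨ ℤ.pos-* (length H-list) (ℓ ℕ.∸ 1) ⟨
    + (length H-list ℕ.* (ℓ ℕ.∸ 1))
      ≡⟨ cong +_ (length-torsionResidues-φ pr N⊥ℓ ℤ.∣ e ∣) ⟩
    + (φ (N ℕ.* ℓ) ℕ.* ℕ.gcd (ℓ ℕ.∸ 1) ℤ.∣ e ∣)
      ≡⟨ ℤ.pos-* (φ (N ℕ.* ℓ)) _ ⟩
    -- The integer gcd is by definition that of the absolute values, so |e| matches e here.
    + φ (N ℕ.* ℓ) ℤ.* + ℕ.gcd (ℓ ℕ.∸ 1) ℤ.∣ e ∣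
      ≡⟨ cong (λ z → + φ (N ℕ.* ℓ) ℤ.* + ℕ.gcd ℤ.∣ z ∣ ℤ.∣ e ∣) ℓ-1≡ ⟨
    + φ (N ℕ.* ℓ) ℤ.* gcd (+ ℓ ℤ.- + 1) e ∎)
  where
  open ≡-Reasoning
  instance
    _ = ℕ.>-nonZero 0<N
  e = + k ℤ.- + 2 ℤ.- + 2 ℤ.* + i
  H-list = torsionResidues pr N⊥ℓ ℤ.∣ e ∣

  1<ℓ : 1 ℕ.< ℓ
  1<ℓ = ℕ.≤-trans (s≤s (s≤s z≤n)) 5≤ℓ

  -- H holds representatives strictly below Nℓ, so 1 can stand for the identity class only if Nℓ
  -- exceeds 1.
  1<Nℓ : 1 ℕ.< N ℕ.* ℓ
  1<Nℓ = ℕ.≤-trans 1<ℓ (ℕ.m≤n*m ℓ N)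

  1∈H-list : 1 ∈ H-list
  1∈H-list = ∈-filter-upTo⁺ _ 1<Nℓ
    ((λ {d} → Coprime.1-coprimeTo (N ℕ.* ℓ) {d}) , mod-reflexive (ℤ.^-zeroˡ ℤ.∣ e ∣))

  ℓ-1≡ : + ℓ ℤ.- + 1 ≡ + (ℓ ℕ.∸ 1)
  ℓ-1≡ = trans (ℤ.m-n≡m⊖n ℓ 1) (ℤ.⊖-≥ (ℕ.<⇒≤ 1<ℓ))
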